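{- Let $l,m\in\mathbb{N}$ and let $q(x)=x^6-(l+m+3)x^4+(lm+l+m+3)x^2-1$. If $q(x)$ is reducible over $\mathbb{Q}$, then the set of all positive eigenvalues of the adjacency matrix of the double subdivided star $T_{l,m}$, with any one of them removed, is linearly independent over $\mathbb{Q}$.
   Context: A subdivided star $SK_{1,l}$ is obtained by identifying exactly one pendant (end) vertex from each of $l$ copies of the path $P_3$ on three vertices; the identified vertex is the coalescence vertex. The double subdivided star $T_{l,m}$ is obtained from $SK_{1,l}$ and $SK_{1,m}$ by adding one edge joining their two coalescence vertices. Eigenvalues are those of the adjacency matrix; the characteristic polynomial of $T_{l,m}$ is $(x^2-1)^{l+m-2}q(x)$. -}

module Defs where

open import Algebra.Bundles.Raw using (RawMonoid)
import Algebra.Definitions.RawMonoid as RawMonoidDefs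
open import Data.Bool.Base using (Bool; true; false; _∧_; _∨_; if_then_else_)
open import Data.Fin.Base using (Fin; zero; suc; toℕ; remQuot; splitAt)
open import Data.Fin.Properties using (_≟_)
open import Data.Integer.Base using (+_)
open import Data.List.Base using (List; []; _∷_; map)
open import Data.Nat.Base as ℕ using (ℕ; zero; suc; _⊔_; _≡ᵇ_)
import Data.Nat.Properties as ℕ
open import Data.Product.Base using (∃; ∃-syntax; _×_; _,_; proj₁)
open import Data.Rational.Base as ℚ using (ℚ; 0ℚ; 1ℚ; ½; ∣_∣; 1/_)
import Data.Rational.Properties as ℚ
open import Data.Rational.Solver using (module +-*-Solver)
open import Data.Sum.Base using (inj₁; inj₂)
open import Data.Vec.Functional using (Vector)
open import Function.Definitions using (Injective)
open import Level using (0ℓ)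
open import Relation.Binary.PropositionalEquality
  using (_≡_; _≢_; refl; sym; trans; cong; subst)
open import Relation.Nullary.Decidable.Core using (⌊_⌋)
open import Relation.Nullary.Negation.Core using (¬_)
open import Relation.Unary using (Pred; _∈_)

-- Reals are Cauchy sequences of rationals, considered up to _≈_; the
-- arithmetic operations are pointwise.
IsCauchy : (ℕ → ℚ) → Set
IsCauchy s = ∀ ε → 0ℚ ℚ.< ε →
  ∃[ N ] (∀ i j → N ℕ.≤ i → N ℕ.≤ j → ∣ s i ℚ.- s j ∣ ℚ.< ε)

record ℝ : Set where
  constructor mkℝ
  field
    seq    : ℕ → ℚ
    cauchy : IsCauchy seq

open ℝ public

infix 4 _≈_ _<_

_≈_ : ℝ → ℝ → Set
x ≈ y = ∀ ε → 0ℚ ℚ.< ε →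
  ∃[ N ] (∀ i → N ℕ.≤ i → ∣ seq x i ℚ.- seq y i ∣ ℚ.< ε)

_<_ : ℝ → ℝ → Set
x < y = ∃[ ε ] (0ℚ ℚ.< ε × ∃[ N ] (∀ i → N ℕ.≤ i → seq x i ℚ.+ ε ℚ.≤ seq y i))

fromℚ : ℚ → ℝ
fromℚ p = mkℝ (λ _ → p) λ ε 0<ε →
  0 , λ _ _ _ _ → subst (ℚ._< ε) (sym (cong ∣_∣ (ℚ.+-inverseʳ p))) 0<ε

0ℝ 1ℝ : ℝ
0ℝ = fromℚ 0ℚ
1ℝ = fromℚ 1ℚ

private
  open +-*-Solver using (solve; _:=_; _:+_; _:*_; _:-_; con)
  open ℚ.≤-Reasoning

  EventuallyBounded : (ℕ → ℚ) → Set
  EventuallyBounded s = ∃[ B ] (0ℚ ℚ.< B × ∃[ N ] (∀ i → N ℕ.≤ i → ∣ s i ∣ ℚ.≤ B))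

  CloseAfter : (ℕ → ℚ) → ℚ → Set
  CloseAfter s ε = ∃[ N ] (∀ i j → N ℕ.≤ i → N ℕ.≤ j → ∣ s i ℚ.- s j ∣ ℚ.< ε)

  +-rearrange : ∀ a b c d →
    (a ℚ.+ b) ℚ.- (c ℚ.+ d) ≡ (a ℚ.- c) ℚ.+ (b ℚ.- d)
  +-rearrange = solve 4 (λ a b c d →
    (a :+ b) :- (c :+ d) := (a :- c) :+ (b :- d)) refl

  *-rearrange : ∀ a b c d →
    a ℚ.* b ℚ.- c ℚ.* d ≡ a ℚ.* (b ℚ.- d) ℚ.+ d ℚ.* (a ℚ.- c)
  *-rearrange = solve 4 (λ a b c d →
    a :* b :- c :* d := a :* (b :- d) :+ d :* (a :- c)) refl

  minus-plus : ∀ a b → a ≡ (a ℚ.- b) ℚ.+ b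
  minus-plus = solve 2 (λ a b → a := (a :- b) :+ b) refl

  half+half : ∀ a → ½ ℚ.* a ℚ.+ ½ ℚ.* a ≡ a
  half+half = solve 1 (λ a → con ½ :* a :+ con ½ :* a := a) refl

  half-pos : ∀ {ε} → 0ℚ ℚ.< ε → 0ℚ ℚ.< ½ ℚ.* ε
  half-pos {ε} 0<ε =
    subst (ℚ._< ½ ℚ.* ε) (ℚ.*-zeroʳ ½) (ℚ.*-monoʳ-<-pos ½ 0<ε)

  +-pos : ∀ {a b} → 0ℚ ℚ.< a → 0ℚ ℚ.< b → 0ℚ ℚ.< a ℚ.+ b
  +-pos {a} {b} 0<a 0<b =
    subst (ℚ._< a ℚ.+ b) (ℚ.+-identityˡ 0ℚ) (ℚ.+-mono-< 0<a 0<b)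

  eventually-bounded : ∀ {s} → IsCauchy s → EventuallyBounded s
  eventually-bounded {s} cs with N , h ← cs 1ℚ (ℚ.positive⁻¹ 1ℚ) =
    1ℚ ℚ.+ ∣ s N ∣ ,
    ℚ.+-mono-<-≤ {0ℚ} {1ℚ} {0ℚ} (ℚ.positive⁻¹ 1ℚ) (ℚ.0≤∣p∣ (s N)) ,
    N , λ i N≤i → begin
      ∣ s i ∣
        ≡⟨ cong ∣_∣ (minus-plus (s i) (s N)) ⟩
      ∣ (s i ℚ.- s N) ℚ.+ s N ∣
        ≤⟨ ℚ.∣p+q∣≤∣p∣+∣q∣ (s i ℚ.- s N) (s N) ⟩
      ∣ s i ℚ.- s N ∣ ℚ.+ ∣ s N ∣
        ≤⟨ ℚ.+-monoˡ-≤ ∣ s N ∣ (ℚ.<⇒≤ (h i N N≤i ℕ.≤-refl)) ⟩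
      1ℚ ℚ.+ ∣ s N ∣ ∎

  *-bound : ∀ {B δ} p q → 0ℚ ℚ.< B → ∣ p ∣ ℚ.≤ B → ∣ q ∣ ℚ.< δ →
            ∣ p ℚ.* q ∣ ℚ.< B ℚ.* δ
  *-bound {B} {δ} p q 0<B p≤B q<δ = begin-strict
    ∣ p ℚ.* q ∣      ≡⟨ ℚ.∣p*q∣≡∣p∣*∣q∣ p q ⟩
    ∣ p ∣ ℚ.* ∣ q ∣  ≤⟨ ℚ.*-monoʳ-≤-nonNeg ∣ q ∣ {{ℚ.∣-∣-nonNeg q}} p≤B ⟩
    B ℚ.* ∣ q ∣      <⟨ ℚ.*-monoʳ-<-pos B {{ℚ.positive 0<B}} q<δ ⟩
    B ℚ.* δ          ∎

  divide : ∀ C {ε} → 0ℚ ℚ.< C → 0ℚ ℚ.< ε → ∃[ δ ] (0ℚ ℚ.< δ × C ℚ.* δ ≡ ε)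
  divide C {ε} 0<C 0<ε = 1/C ℚ.* ε , 0<δ , Cδ≡ε
    where
    C-pos : ℚ.Positive C
    C-pos = ℚ.positive 0<C

    C-nonZero : ℚ.NonZero C
    C-nonZero = ℚ.pos⇒nonZero C {{C-pos}}

    1/C : ℚ
    1/C = (1/ C) {{C-nonZero}}

    0<δ : 0ℚ ℚ.< 1/C ℚ.* ε
    0<δ = subst (ℚ._< 1/C ℚ.* ε) (ℚ.*-zeroʳ 1/C)
            (ℚ.*-monoʳ-<-pos 1/C {{ℚ.1/pos⇒pos C {{C-pos}}}} 0<ε)

    Cδ≡ε : C ℚ.* (1/C ℚ.* ε) ≡ ε
    Cδ≡ε = trans (sym (ℚ.*-assoc C 1/C ε))
             (trans (cong (ℚ._* ε) (ℚ.*-inverseʳ C {{C-nonZero}})) (ℚ.*-identityˡ ε))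

  *-close : ∀ {A B δ} a b c d → 0ℚ ℚ.< A → 0ℚ ℚ.< B →
    ∣ a ∣ ℚ.≤ A → ∣ d ∣ ℚ.≤ B → ∣ a ℚ.- c ∣ ℚ.< δ → ∣ b ℚ.- d ∣ ℚ.< δ →
    ∣ a ℚ.* b ℚ.- c ℚ.* d ∣ ℚ.< (A ℚ.+ B) ℚ.* δ
  *-close {A} {B} {δ} a b c d 0<A 0<B a≤A d≤B ac bd = begin-strict
    ∣ a ℚ.* b ℚ.- c ℚ.* d ∣
      ≡⟨ cong ∣_∣ (*-rearrange a b c d) ⟩
    ∣ a ℚ.* (b ℚ.- d) ℚ.+ d ℚ.* (a ℚ.- c) ∣
      ≤⟨ ℚ.∣p+q∣≤∣p∣+∣q∣ (a ℚ.* (b ℚ.- d)) (d ℚ.* (a ℚ.- c)) ⟩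
    ∣ a ℚ.* (b ℚ.- d) ∣ ℚ.+ ∣ d ℚ.* (a ℚ.- c) ∣
      <⟨ ℚ.+-mono-< (*-bound a (b ℚ.- d) 0<A a≤A bd)
                    (*-bound d (a ℚ.- c) 0<B d≤B ac) ⟩
    A ℚ.* δ ℚ.+ B ℚ.* δ
      ≡⟨ sym (ℚ.*-distribʳ-+ δ A B) ⟩
    (A ℚ.+ B) ℚ.* δ ∎

  *-closeAfter : ∀ {s t δ} →
    (bs : EventuallyBounded s) (bt : EventuallyBounded t) →
    CloseAfter s δ → CloseAfter t δ →
    CloseAfter (λ i → s i ℚ.* t i) ((proj₁ bs ℚ.+ proj₁ bt) ℚ.* δ)
  *-closeAfter {s} {t} (A , 0<A , K , bs) (B , 0<B , L , bt) (M , hs) (N , ht) =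
    (K ⊔ L) ⊔ (M ⊔ N) , λ i j Pi Pj →
      let KLi = ℕ.m⊔n≤o⇒m≤o (K ⊔ L) (M ⊔ N) Pi
          KLj = ℕ.m⊔n≤o⇒m≤o (K ⊔ L) (M ⊔ N) Pj
          MNi = ℕ.m⊔n≤o⇒n≤o (K ⊔ L) (M ⊔ N) Pi
          MNj = ℕ.m⊔n≤o⇒n≤o (K ⊔ L) (M ⊔ N) Pj
      in *-close (s i) (t i) (s j) (t j) 0<A 0<B
           (bs i (ℕ.m⊔n≤o⇒m≤o K L KLi)) (bt j (ℕ.m⊔n≤o⇒n≤o K L KLj))
           (hs i j (ℕ.m⊔n≤o⇒m≤o M N MNi) (ℕ.m⊔n≤o⇒m≤o M N MNj))
           (ht i j (ℕ.m⊔n≤o⇒n≤o M N MNi) (ℕ.m⊔n≤o⇒n≤o M N MNj))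

  abstract
    +-cauchy : ∀ s t → IsCauchy s → IsCauchy t → IsCauchy (λ i → s i ℚ.+ t i)
    +-cauchy s t cs ct ε 0<ε
      with M , hs ← cs (½ ℚ.* ε) (half-pos 0<ε)
      with N , ht ← ct (½ ℚ.* ε) (half-pos 0<ε)
      = M ⊔ N , λ i j Ki Kj → begin-strict
        ∣ (s i ℚ.+ t i) ℚ.- (s j ℚ.+ t j) ∣
          ≡⟨ cong ∣_∣ (+-rearrange (s i) (t i) (s j) (t j)) ⟩
        ∣ (s i ℚ.- s j) ℚ.+ (t i ℚ.- t j) ∣
          ≤⟨ ℚ.∣p+q∣≤∣p∣+∣q∣ (s i ℚ.- s j) (t i ℚ.- t j) ⟩
        ∣ s i ℚ.- s j ∣ ℚ.+ ∣ t i ℚ.- t j ∣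
          <⟨ ℚ.+-mono-<
               (hs i j (ℕ.m⊔n≤o⇒m≤o M N Ki) (ℕ.m⊔n≤o⇒m≤o M N Kj))
               (ht i j (ℕ.m⊔n≤o⇒n≤o M N Ki) (ℕ.m⊔n≤o⇒n≤o M N Kj)) ⟩
        ½ ℚ.* ε ℚ.+ ½ ℚ.* ε
          ≡⟨ half+half ε ⟩
        ε ∎

    *-cauchy : ∀ s t → IsCauchy s → IsCauchy t → IsCauchy (λ i → s i ℚ.* t i)
    *-cauchy s t cs ct ε 0<ε = go (eventually-bounded cs) (eventually-bounded ct)
      where
      go : EventuallyBounded s → EventuallyBounded t →
           CloseAfter (λ i → s i ℚ.* t i) ε
      go bs@(A , 0<A , _) bt@(B , 0<B , _) =
        use (divide (A ℚ.+ B) (+-pos 0<A 0<B) 0<ε)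
        where
        use : ∃[ δ ] (0ℚ ℚ.< δ × (A ℚ.+ B) ℚ.* δ ≡ ε) →
              CloseAfter (λ i → s i ℚ.* t i) ε
        use (δ , 0<δ , Cδ≡ε) =
          subst (CloseAfter (λ i → s i ℚ.* t i)) Cδ≡ε
            (*-closeAfter {s} {t} {δ} bs bt (cs δ 0<δ) (ct δ 0<δ))

infixl 6 _+_
infixl 7 _*_

_+_ : ℝ → ℝ → ℝ
x + y = mkℝ (λ i → seq x i ℚ.+ seq y i) (+-cauchy (seq x) (seq y) (cauchy x) (cauchy y))

_*_ : ℝ → ℝ → ℝ
x * y = mkℝ (λ i → seq x i ℚ.* seq y i) (*-cauchy (seq x) (seq y) (cauchy x) (cauchy y))

+-0-rawMonoid : RawMonoid 0ℓ 0ℓ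
+-0-rawMonoid = record { Carrier = ℝ ; _≈_ = _≈_ ; _∙_ = _+_ ; ε = 0ℝ }

open RawMonoidDefs +-0-rawMonoid public using (sum)

-- Finite families of elements of S are required to be pairwise distinct
-- with respect to _≈_.
LinearlyIndependent : Pred ℝ 0ℓ → Set
LinearlyIndependent S =
  ∀ n (x : Vector ℝ n) → (∀ i → x i ∈ S) → Injective _≡_ _≈_ x →
  ∀ (c : Vector ℚ n) → sum (λ i → fromℚ (c i) * x i) ≈ 0ℝ →
  ∀ i → c i ≡ 0ℚ

infixl 6 _∖_

_∖_ : Pred ℝ 0ℓ → ℝ → Pred ℝ 0ℓ
(S ∖ y) x = x ∈ S × ¬ (x ≈ y)

Matrix : ℕ → Set
Matrix n = Fin n → Fin n → ℝ

Eigenvalue : ∀ {n} → Matrix n → Pred ℝ 0ℓ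
Eigenvalue {n} A μ = ∃ λ (v : Vector ℝ n) →
  ¬ (∀ i → v i ≈ 0ℝ) × (∀ i → sum (λ j → A i j * v j) ≈ μ * v i)

PositiveEigenvalue : ∀ {n} → Matrix n → Pred ℝ 0ℓ
PositiveEigenvalue A μ = Eigenvalue A μ × 0ℝ < μ

Graph : ℕ → Set
Graph n = Fin n → Fin n → Bool

adjacencyMatrix : ∀ {n} → Graph n → Matrix n
adjacencyMatrix G i j = if G i j then 1ℝ else 0ℝ

-- The path 0 — 1 — ⋯ — (n-1); for n ≥ 2 the vertex 0 is pendant.
path : ∀ n → Graph n
path n i j = (suc (toℕ i) ≡ᵇ toℕ j) ∨ (suc (toℕ j) ≡ᵇ toℕ i)

-- The vertices 0 of l copies of G are identified to the single vertex 0.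
-- With remQuot n k = (a , u), the vertex suc k is the vertex suc u of
-- the a-th copy.
coalesce : ∀ l {n} → Graph (suc n) → Graph (suc (l ℕ.* n))
coalesce l {n} G zero zero = false
coalesce l {n} G zero (suc k) with remQuot {l} n k
... | _ , u = G zero (suc u)
coalesce l {n} G (suc k) zero with remQuot {l} n k
... | _ , u = G (suc u) zero
coalesce l {n} G (suc k) (suc k′) with remQuot {l} n k | remQuot {l} n k′
... | a , u | b , w = ⌊ a ≟ b ⌋ ∧ G (suc u) (suc w)

-- The disjoint union of G and H plus one edge between their vertices 0.
bridge : ∀ {m n} → Graph (suc m) → Graph (suc n) → Graph (suc m ℕ.+ suc n)
bridge {m} G H i j with splitAt (suc m) i | splitAt (suc m) j
... | inj₁ u    | inj₁ w    = G u w
... | inj₂ u    | inj₂ w    = H u w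
... | inj₁ zero | inj₂ zero = true
... | inj₂ zero | inj₁ zero = true
... | _         | _         = false

subdividedStar : ∀ l → Graph (suc (l ℕ.* 2))
subdividedStar l = coalesce l (path 3)

doubleSubdividedStar : ∀ l m → Graph (suc (l ℕ.* 2) ℕ.+ suc (m ℕ.* 2))
doubleSubdividedStar l m = bridge (subdividedStar l) (subdividedStar m)

-- ℚ[x] as coefficient lists, constant term first, considered up to
-- trailing zeros.
Poly : Set
Poly = List ℚ

coeff : Poly → ℕ → ℚ
coeff []      _       = 0ℚ
coeff (a ∷ _) zero    = a
coeff (_ ∷ f) (suc k) = coeff f k

infix 4 _≈ₚ_
infixl 6 _+ₚ_
infixl 7 _*ₚ_

_≈ₚ_ : Poly → Poly → Set
f ≈ₚ g = ∀ k → coeff f k ≡ coeff g k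

_+ₚ_ : Poly → Poly → Poly
[]      +ₚ g       = g
(a ∷ f) +ₚ []      = a ∷ f
(a ∷ f) +ₚ (b ∷ g) = a ℚ.+ b ∷ f +ₚ g

_*ₚ_ : Poly → Poly → Poly
[]      *ₚ g = []
(a ∷ f) *ₚ g = map (a ℚ.*_) g +ₚ (0ℚ ∷ f *ₚ g)

NonConstant : Poly → Set
NonConstant f = ∃[ k ] coeff f (suc k) ≢ 0ℚ

Reducible : Poly → Set
Reducible f = ∃[ g ] ∃[ h ] (NonConstant g × NonConstant h × f ≈ₚ g *ₚ h)

fromℕ : ℕ → ℚ
fromℕ n = + n ℚ./ 1

-- x⁶ − (l+m+3)x⁴ + (lm+l+m+3)x² − 1
q : ℕ → ℕ → Poly
q l m = ℚ.- 1ℚ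
      ∷ 0ℚ
      ∷ fromℕ (l ℕ.* m ℕ.+ l ℕ.+ m ℕ.+ 3)
      ∷ 0ℚ
      ∷ ℚ.- fromℕ (l ℕ.+ m ℕ.+ 3)
      ∷ 0ℚ
      ∷ 1ℚ
      ∷ []

{-# OPTIONS --safe #-}
-- Put z = μ². Eliminating the entries of an eigenvector gives μ = 1 or c(z) = 0
-- for c = y³ - (l+m+3) y² + (lm+l+m+3) y - 1, so that q(x) = c(x²).
--
-- If lm ≠ 0, then c has no rational root, hence c is irreducible, and a proper
-- factor of q puts μ in ℚ(z). Then q(x) = - g(x) g(-x) for some
-- g = x³ + a x² + b x + d, and the positive roots of q are, up to sign, the three
-- roots of g. Two of them are linearly independent together with 1: an affine
-- map over ℚ taking one root of the irreducible g to another scales g, fixes the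
-- centre -a/3 of its roots, and so is the identity. All three are independent
-- because their sum -a is not 0, as (l+m+3)² ≠ 4 (lm+l+m+3).
--
-- If lm = 0, then c = (y - 1)(y² - (l+m+2) y + 1), and at most two positive
-- eigenvalues differ from 1.
--
-- Equality of reals is not decidable, but the conclusion is an equation between
-- rationals, so that all case distinctions may be made under a double negation.
module Submission where

open import Defs hiding (_+_; _*_)
open import Defs using () renaming (_+_ to _⊕_; _*_ to _⊗_)
open import Data.Bool.Base using (Bool; true; false; _∧_; if_then_else_)
open import Data.Empty using (⊥; ⊥-elim)
open import Data.Fin.Base using (Fin; zero; suc; _↑ˡ_; _↑ʳ_; combine; remQuot; splitAt)
open import Data.Fin.Patterns using (0F; 1F; 2F; 3F)
import Data.Fin.Properties as Fin
open import Data.Integer.Base as ℤ using (ℤ; +_; -[1+_])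
import Data.Integer.Properties as ℤ
import Data.Integer.Tactic.RingSolver as ℤ-Solver
open import Data.List.Base using ([]; _∷_; map)
open import Data.Nat.Base as ℕ using (ℕ; zero; suc; _⊔_; s≤s; z<s; s<s)
open import Data.Nat.Coprimality as Coprimality using (Coprime; coprime-divisor)
open import Data.Nat.Divisibility using (divides; ∣1⇒≡1)
import Data.Nat.Properties as ℕ
open import Data.Product.Base using (∃-syntax; _×_; _,_; proj₁; proj₂)
open import Data.Rational.Base as ℚ using (ℚ; mkℚ; 0ℚ; 1ℚ; ½; ∣_∣; 1/_; _+_; _*_; _-_; -_)
open import Data.Rational.Literals using (fromℤ)
import Data.Rational.Properties as ℚ
import Data.Rational.Unnormalised.Base as ℚᵘ
import Data.Rational.Unnormalised.Properties as ℚᵘ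
open import Data.Sum.Base using (_⊎_; inj₁; inj₂)
open import Data.Vec.Functional using (Vector)
open import Level using (0ℓ)
open import Relation.Binary.PropositionalEquality
open import Relation.Nullary.Decidable using (Dec; yes; no; ⌊_⌋; dec⇒maybe; decidable-stable; _×-dec_)
open import Relation.Nullary.Negation using (¬_; contradiction)
open import Relation.Unary using (Pred)
open import Tactic.RingSolver using (solve-∀)
open import Tactic.RingSolver.Core.AlmostCommutativeRing using (AlmostCommutativeRing; fromCommutativeRing)

-- Real numbers

-- Roots are never constructed: the argument takes place at given reals, where the irreducibility of
-- c appears as the independence of 1, z, z². The polynomial g comes from a single eigenvalue μ. If
-- μ = e₀ + e₁ z + e₂ z² with e₂ ≠ 0, some b makes the z² term of μ (z + b) vanish, so that μ (z +
-- b) = - (a z + d), which says g(μ) = 0. Multiplying by the conjugate μ (z + b) - (a z + d) gives a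
-- monic cubic relation for z, which can only be c. As g depends on μ only through rational
-- coefficients tied to c, it serves all other eigenvalues too. The removal of one element is what
-- breaks the remaining relations: the three signed roots of g have the rational sum -a, a relation
-- with the eigenvalue 1; and for lm = 0 the two eigenvalues x and 1/x besides 1 may have a rational
-- sum.

ℚ-ring : AlmostCommutativeRing 0ℓ 0ℓ
ℚ-ring = fromCommutativeRing ℚ.+-*-commutativeRing (λ p → dec⇒maybe (0ℚ ℚ.≟ p))

private
  half+half : ∀ p → ½ * p + ½ * p ≡ p
  half+half = solve-∀ ℚ-ring

*-pos : ∀ {p q} → 0ℚ ℚ.< p → 0ℚ ℚ.< q → 0ℚ ℚ.< p * q
*-pos {p} {q} 0<p 0<q =
  ℚ.positive⁻¹ (p * q) {{ℚ.pos*pos⇒pos p {{ℚ.positive 0<p}} q {{ℚ.positive 0<q}}}}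

half-pos : ∀ {p} → 0ℚ ℚ.< p → 0ℚ ℚ.< ½ * p
half-pos = *-pos (ℚ.positive⁻¹ ½)

Small : (ℕ → ℚ) → ℚ → Set
Small s ε = ∃[ N ] (∀ i → N ℕ.≤ i → ∣ s i ∣ ℚ.< ε)

Null : (ℕ → ℚ) → Set
Null s = ∀ ε → 0ℚ ℚ.< ε → Small s ε

BoundedAway : (ℕ → ℚ) → Set
BoundedAway s = ∃[ δ ] (0ℚ ℚ.< δ × ∃[ N ] (∀ i → N ℕ.≤ i → δ ℚ.≤ ∣ s i ∣))

null-cong : ∀ {s t} → (∀ i → t i ≡ s i) → Null s → Null t
null-cong t≡s ns ε 0<ε with N , h ← ns ε 0<ε =
  N , λ i N≤i → subst (λ p → ∣ p ∣ ℚ.< ε) (sym (t≡s i)) (h i N≤i)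

null-+ : ∀ {s t} → Null s → Null t → Null (λ i → s i + t i)
null-+ {s} {t} ns nt ε 0<ε
  with M , hs ← ns (½ * ε) (half-pos 0<ε)
  with N , ht ← nt (½ * ε) (half-pos 0<ε) =
  M ⊔ N , λ i P → begin-strict
    ∣ s i + t i ∣          ≤⟨ ℚ.∣p+q∣≤∣p∣+∣q∣ (s i) (t i) ⟩
    ∣ s i ∣ + ∣ t i ∣      <⟨ ℚ.+-mono-< (hs i (ℕ.m⊔n≤o⇒m≤o M N P)) (ht i (ℕ.m⊔n≤o⇒n≤o M N P)) ⟩
    ½ * ε + ½ * ε      ≡⟨ half+half ε ⟩
    ε                        ∎
  where open ℚ.≤-Reasoning

eventually-bounded : ∀ x → ∃[ B ] (0ℚ ℚ.< B × ∃[ N ] (∀ i → N ℕ.≤ i → ∣ seq x i ∣ ℚ.≤ B))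
eventually-bounded (mkℝ s cs) with N , h ← cs 1ℚ (ℚ.positive⁻¹ 1ℚ) =
  1ℚ + ∣ s N ∣ ,
  ℚ.+-mono-<-≤ {0ℚ} {1ℚ} {0ℚ} (ℚ.positive⁻¹ 1ℚ) (ℚ.0≤∣p∣ (s N)) ,
  N , λ i N≤i → begin
    ∣ s i ∣                        ≡⟨ cong ∣_∣ (p≡p-q+q (s i) (s N)) ⟩
    ∣ (s i - s N) + s N ∣      ≤⟨ ℚ.∣p+q∣≤∣p∣+∣q∣ (s i - s N) (s N) ⟩
    ∣ s i - s N ∣ + ∣ s N ∣    ≤⟨ ℚ.+-monoˡ-≤ ∣ s N ∣ (ℚ.<⇒≤ (h i N N≤i ℕ.≤-refl)) ⟩
    1ℚ + ∣ s N ∣                 ∎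
  where
  open ℚ.≤-Reasoning
  p≡p-q+q : ∀ p q → p ≡ (p - q) + q
  p≡p-q+q = solve-∀ ℚ-ring

divide : ∀ {B ε} → 0ℚ ℚ.< B → 0ℚ ℚ.< ε → ∃[ δ ] (0ℚ ℚ.< δ × B * δ ≡ ε)
divide {B} {ε} 0<B 0<ε = 1/B * ε , *-pos (ℚ.positive⁻¹ 1/B {{ℚ.1/pos⇒pos B {{B-pos}}}}) 0<ε ,
  trans (sym (ℚ.*-assoc B 1/B ε))
    (trans (cong (_* ε) (ℚ.*-inverseʳ B {{B-nonZero}})) (ℚ.*-identityˡ ε))
  where
  B-pos : ℚ.Positive B
  B-pos = ℚ.positive 0<B
  B-nonZero : ℚ.NonZero B
  B-nonZero = ℚ.pos⇒nonZero B {{B-pos}}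
  1/B : ℚ
  1/B = (1/ B) {{B-nonZero}}

null-* : ∀ x {t} → Null t → Null (λ i → seq x i * t i)
null-* x {t} nt ε 0<ε = go (eventually-bounded x)
  where
  open ℚ.≤-Reasoning
  go : ∃[ B ] (0ℚ ℚ.< B × ∃[ N ] (∀ i → N ℕ.≤ i → ∣ seq x i ∣ ℚ.≤ B)) →
       Small (λ i → seq x i * t i) ε
  go (B , 0<B , M , hx) = use (divide 0<B 0<ε)
    where
    bound : ∀ {p q δ} → ∣ p ∣ ℚ.≤ B → ∣ q ∣ ℚ.< δ → ∣ p * q ∣ ℚ.< B * δ
    bound {p} {q} {δ} p≤B q<δ = begin-strict
      ∣ p * q ∣      ≡⟨ ℚ.∣p*q∣≡∣p∣*∣q∣ p q ⟩
      ∣ p ∣ * ∣ q ∣  ≤⟨ ℚ.*-monoʳ-≤-nonNeg ∣ q ∣ {{ℚ.∣-∣-nonNeg q}} p≤B ⟩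
      B * ∣ q ∣      <⟨ ℚ.*-monoʳ-<-pos B {{ℚ.positive 0<B}} q<δ ⟩
      B * δ          ∎
    use : ∃[ δ ] (0ℚ ℚ.< δ × B * δ ≡ ε) → Small (λ i → seq x i * t i) ε
    use (δ , 0<δ , Bδ≡ε) = finish (nt δ 0<δ)
      where
      finish : Small t δ → Small (λ i → seq x i * t i) ε
      finish (N , ht) = M ⊔ N , λ i P → subst (∣ seq x i * t i ∣ ℚ.<_) Bδ≡ε
        (bound (hx i (ℕ.m⊔n≤o⇒m≤o M N P)) (ht i (ℕ.m⊔n≤o⇒n≤o M N P)))

-- Comparing a single term, taken beyond the index for ε/4, with ε/2 decides the alternative,
-- because later terms differ from it by less than ε/4. This replaces the undecidable question
-- whether x is 0.
small-or-boundedAway : ∀ x ε → 0ℚ ℚ.< ε → Small (seq x) ε ⊎ BoundedAway (seq x)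
small-or-boundedAway (mkℝ s cs) ε 0<ε with cs (½ * (½ * ε)) (half-pos (half-pos 0<ε))
... | N , h = cases (∣ s N ∣ ℚ.<? η)
  where
  open ℚ.≤-Reasoning
  η θ : ℚ
  η = ½ * ε
  θ = ½ * η
  θ≤η : θ ℚ.≤ η
  θ≤η = begin
    θ            ≡⟨ ℚ.+-identityʳ θ ⟨
    θ + 0ℚ     ≤⟨ ℚ.+-monoʳ-≤ θ (ℚ.<⇒≤ (half-pos (half-pos 0<ε))) ⟩
    θ + θ      ≡⟨ half+half η ⟩
    η            ∎
  upper : ∀ p q → p ≡ (p - q) + q
  upper = solve-∀ ℚ-ring
  lower : ∀ p q → q ≡ p - (p - q)
  lower = solve-∀ ℚ-ring
  cancel : ∀ p q → p ≡ (p + q) - q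
  cancel = solve-∀ ℚ-ring
  cases : _ → Small s ε ⊎ BoundedAway s
  cases (yes sN<η) = inj₁ (N , λ i N≤i → begin-strict
    ∣ s i ∣                        ≡⟨ cong ∣_∣ (upper (s i) (s N)) ⟩
    ∣ (s i - s N) + s N ∣      ≤⟨ ℚ.∣p+q∣≤∣p∣+∣q∣ (s i - s N) (s N) ⟩
    ∣ s i - s N ∣ + ∣ s N ∣    <⟨ ℚ.+-mono-< (h i N N≤i ℕ.≤-refl) sN<η ⟩
    θ + η                        ≤⟨ ℚ.+-monoˡ-≤ η θ≤η ⟩
    η + η                        ≡⟨ half+half ε ⟩
    ε                              ∎)
  cases (no sN≮η) = inj₂ (θ , half-pos (half-pos 0<ε) , N , λ i N≤i → begin
    θ                                    ≡⟨ cancel θ θ ⟩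
    (θ + θ) - θ                      ≡⟨ cong (_- θ) (half+half η) ⟩
    η - θ                              ≤⟨ ℚ.+-monoˡ-≤ (- θ) (ℚ.≮⇒≥ sN≮η) ⟩
    ∣ s N ∣ - θ                        ≡⟨ cong (λ p → ∣ p ∣ - θ) (lower (s i) (s N)) ⟩
    ∣ s i - (s i - s N) ∣ - θ      ≤⟨ ℚ.+-monoˡ-≤ (- θ) (ℚ.∣p-q∣≤∣p∣+∣q∣ (s i) (s i - s N)) ⟩
    ∣ s i ∣ + ∣ s i - s N ∣ - θ    ≤⟨ ℚ.+-monoˡ-≤ (- θ) (ℚ.+-monoʳ-≤ ∣ s i ∣ (ℚ.<⇒≤ (h i N N≤i ℕ.≤-refl))) ⟩
    ∣ s i ∣ + θ - θ                  ≡⟨ cancel ∣ s i ∣ θ ⟨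
    ∣ s i ∣                              ∎)

boundedAway⇒¬null : ∀ {s} → BoundedAway s → ¬ Null s
boundedAway⇒¬null (δ , 0<δ , M , lower) ns with N , upper ← ns δ 0<δ =
  ℚ.<-irrefl refl (ℚ.<-≤-trans (upper (M ⊔ N) (ℕ.m≤n⊔m M N)) (lower (M ⊔ N) (ℕ.m≤m⊔n M N)))

boundedAway-* : ∀ {s t} → BoundedAway s → BoundedAway t → BoundedAway (λ i → s i * t i)
boundedAway-* {s} {t} (δ , 0<δ , M , hs) (ε , 0<ε , N , ht) =
  δ * ε , *-pos 0<δ 0<ε , M ⊔ N , λ i P → begin
    δ * ε              ≤⟨ ℚ.*-monoˡ-≤-nonNeg δ {{ℚ.nonNegative (ℚ.<⇒≤ 0<δ)}} (ht i (ℕ.m⊔n≤o⇒n≤o M N P)) ⟩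
    δ * ∣ t i ∣        ≤⟨ ℚ.*-monoʳ-≤-nonNeg ∣ t i ∣ {{ℚ.∣-∣-nonNeg (t i)}} (hs i (ℕ.m⊔n≤o⇒m≤o M N P)) ⟩
    ∣ s i ∣ * ∣ t i ∣  ≡⟨ ℚ.∣p*q∣≡∣p∣*∣q∣ (s i) (t i) ⟨
    ∣ s i * t i ∣      ∎
  where open ℚ.≤-Reasoning

-- Equality of reals, and equations as linear combinations of others

infix 4 _≃_ _≄_

-- A record around _≈_, so that Agda can infer the two sides of an equation.
record _≃_ (x y : ℝ) : Set where
  constructor wrap
  field unwrap : x ≈ y

open _≃_ public

_≄_ : ℝ → ℝ → Set
x ≄ y = ¬ (x ≃ y)

-- Since the operations on ℝ are pointwise, an equation e ≃ f follows from
-- given ones as soon as e - f is a linear combination of the given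
-- differences at each index, which is an identity in ℚ.
by-identity : ∀ {e f} → (∀ i → seq e i - seq f i ≡ 0ℚ) → e ≃ f
by-identity id = wrap λ ε 0<ε → 0 , λ i _ → subst (λ p → ∣ p ∣ ℚ.< ε) (sym (id i)) 0<ε

combine₁ : ∀ a {x y e f} → x ≃ y →
  (∀ i → seq e i - seq f i ≡ seq a i * (seq x i - seq y i)) → e ≃ f
combine₁ a (wrap p) id = wrap (null-cong id (null-* a p))

combine₂ : ∀ a b {x y z w e f} → x ≃ y → z ≃ w →
  (∀ i → seq e i - seq f i ≡
    seq a i * (seq x i - seq y i) + seq b i * (seq z i - seq w i)) → e ≃ f
combine₂ a b (wrap p) (wrap q) id = wrap (null-cong id (null-+ (null-* a p) (null-* b q)))

combine₃ : ∀ a b c {x y z w u v e f} → x ≃ y → z ≃ w → u ≃ v →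
  (∀ i → seq e i - seq f i ≡
    seq a i * (seq x i - seq y i) + seq b i * (seq z i - seq w i)
      + seq c i * (seq u i - seq v i)) → e ≃ f
combine₃ a b c (wrap p) (wrap q) (wrap r) id =
  wrap (null-cong id (null-+ (null-+ (null-* a p) (null-* b q)) (null-* c r)))

≃-refl : ∀ {x} → x ≃ x
≃-refl {x} = by-identity λ i → ℚ.+-inverseʳ (seq x i)

≃-sym : ∀ {x y} → x ≃ y → y ≃ x
≃-sym {x} {y} x≃y = combine₁ (fromℚ (- 1ℚ)) x≃y λ i → id (seq x i) (seq y i)
  where
  id : ∀ x y → y - x ≡ - 1ℚ * (x - y)
  id = solve-∀ ℚ-ring

≃-trans : ∀ {x y z} → x ≃ y → y ≃ z → x ≃ z
≃-trans {x} {y} {z} x≃y y≃z = combine₂ 1ℝ 1ℝ x≃y y≃z λ i → id (seq x i) (seq y i) (seq z i)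
  where
  id : ∀ x y z → x - z ≡ 1ℚ * (x - y) + 1ℚ * (y - z)
  id = solve-∀ ℚ-ring

≄-sym : ∀ {x y} → x ≄ y → y ≄ x
≄-sym x≄y y≃x = x≄y (≃-sym y≃x)

private
  p-0≡p : ∀ p → p - 0ℚ ≡ p
  p-0≡p = solve-∀ ℚ-ring

≃0⇒null : ∀ {x} → x ≃ 0ℝ → Null (seq x)
≃0⇒null {x} (wrap p) = null-cong (λ i → sym (p-0≡p (seq x i))) p

null⇒≃0 : ∀ {x} → Null (seq x) → x ≃ 0ℝ
null⇒≃0 {x} p = wrap (null-cong (λ i → p-0≡p (seq x i)) p)

-- At each ε the alternative `BoundedAway` would make x nonzero, so `Small` holds. Equations with 0
-- may therefore be proved under a double negation.
≃0-stable : ∀ {x} → ¬ (x ≄ 0ℝ) → x ≃ 0ℝ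
≃0-stable {x} ¬x≄0 = null⇒≃0 λ ε 0<ε → case (small-or-boundedAway x ε 0<ε)
  where
  case : ∀ {ε} → Small (seq x) ε ⊎ BoundedAway (seq x) → Small (seq x) ε
  case (inj₁ small) = small
  case (inj₂ away)  = ⊥-elim (¬x≄0 λ x≃0 → boundedAway⇒¬null away (≃0⇒null x≃0))

-- If y were bounded away from 0, then x could not be, since the product would be too; x would then
-- be small at every ε, against x ≄ 0.
x*y≃0⇒y≃0 : ∀ x y → x ⊗ y ≃ 0ℝ → x ≄ 0ℝ → y ≃ 0ℝ
x*y≃0⇒y≃0 x y xy≃0 x≄0 = null⇒≃0 λ ε 0<ε → caseʸ (small-or-boundedAway y ε 0<ε)
  where
  caseˣ : ∀ {ε} → BoundedAway (seq y) → Small (seq x) ε ⊎ BoundedAway (seq x) → Small (seq x) ε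
  caseˣ y-away (inj₁ small)  = small
  caseˣ y-away (inj₂ x-away) =
    ⊥-elim (boundedAway⇒¬null (boundedAway-* x-away y-away) (≃0⇒null xy≃0))
  caseʸ : ∀ {ε} → Small (seq y) ε ⊎ BoundedAway (seq y) → Small (seq y) ε
  caseʸ (inj₁ small) = small
  caseʸ (inj₂ away)  =
    ⊥-elim (x≄0 (null⇒≃0 λ ε 0<ε → caseˣ away (small-or-boundedAway x ε 0<ε)))

fromℚ≃0⇒≡0 : ∀ {p} → fromℚ p ≃ 0ℝ → p ≡ 0ℚ
fromℚ≃0⇒≡0 {p} p≃0 with p ℚ.≟ 0ℚ
... | yes p≡0 = p≡0
... | no p≢0  = ⊥-elim (boundedAway⇒¬null away (≃0⇒null p≃0))
  where
  away : BoundedAway (λ _ → p)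
  away = ∣ p ∣ , ℚ.≰⇒> (λ ∣p∣≤0 → p≢0 (ℚ.∣p∣≡0⇒p≡0 p (ℚ.≤-antisym ∣p∣≤0 (ℚ.0≤∣p∣ p)))) ,
         0 , λ _ _ → ℚ.≤-refl

positive⇒≄0 : ∀ {x} → 0ℝ < x → x ≄ 0ℝ
positive⇒≄0 {x} (ε , 0<ε , N , h) x≃0 = boundedAway⇒¬null (ε , 0<ε , N , bound) (≃0⇒null x≃0)
  where
  open ℚ.≤-Reasoning
  bound : ∀ i → N ℕ.≤ i → ε ℚ.≤ ∣ seq x i ∣
  bound i N≤i = begin
    ε             ≡⟨ ℚ.+-identityˡ ε ⟨
    0ℚ + ε      ≤⟨ h i N≤i ⟩
    seq x i       ≤⟨ p≤∣p∣ (seq x i) ⟩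
    ∣ seq x i ∣   ∎
    where
    p≤∣p∣ : ∀ p → p ℚ.≤ ∣ p ∣
    p≤∣p∣ p with ℚ.≤-total 0ℚ p
    ... | inj₁ 0≤p = ℚ.≤-reflexive (sym (ℚ.0≤p⇒∣p∣≡p 0≤p))
    ... | inj₂ p≤0 = ℚ.≤-trans p≤0 (ℚ.0≤∣p∣ p)

+-positive : ∀ {x y} → 0ℝ < x → 0ℝ < y → 0ℝ < x ⊕ y
+-positive {x} {y} (δ , 0<δ , M , hx) (ε , 0<ε , N , hy) =
  δ , 0<δ , M ⊔ N , λ i P → begin
    0ℚ + δ                 ≡⟨ ℚ.+-identityʳ (0ℚ + δ) ⟨
    (0ℚ + δ) + 0ℚ        ≤⟨ ℚ.+-mono-≤ (hx i (ℕ.m⊔n≤o⇒m≤o M N P)) (ℚ.<⇒≤ (0<y i (ℕ.m⊔n≤o⇒n≤o M N P))) ⟩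
    seq x i + seq y i      ∎
  where
  open ℚ.≤-Reasoning
  0<y : ∀ i → N ℕ.≤ i → 0ℚ ℚ.< seq y i
  0<y i N≤i = ℚ.<-≤-trans (subst (0ℚ ℚ.<_) (sym (ℚ.+-identityˡ ε)) 0<ε) (hy i N≤i)

1-positive : 0ℝ < 1ℝ
1-positive = 1ℚ , ℚ.positive⁻¹ 1ℚ , 0 , λ _ _ → ℚ.≤-refl

-- Cubic irrationals

p-q≡0⇒p≡q : ∀ {p q} → p - q ≡ 0ℚ → p ≡ q
p-q≡0⇒p≡q {p} {q} p-q≡0 = trans (id p q) (trans (cong (_+ q) p-q≡0) (ℚ.+-identityˡ q))
  where
  id : ∀ p q → p ≡ p - q + q
  id = solve-∀ ℚ-ring

combineℚ₁ : ∀ a {x y e f} → x ≡ y → e - f ≡ a * (x - y) → e ≡ f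
combineℚ₁ a {x} refl id = p-q≡0⇒p≡q (trans id (id′ a x))
  where
  id′ : ∀ a x → a * (x - x) ≡ 0ℚ
  id′ = solve-∀ ℚ-ring

combineℚ₂ : ∀ a b {x y z w e f} → x ≡ y → z ≡ w → e - f ≡ a * (x - y) + b * (z - w) → e ≡ f
combineℚ₂ a b {x} {z = z} refl refl id = p-q≡0⇒p≡q (trans id (id′ a b x z))
  where
  id′ : ∀ a b x z → a * (x - x) + b * (z - z) ≡ 0ℚ
  id′ = solve-∀ ℚ-ring

combineℚ₃ : ∀ a b c {x y z w u v e f} → x ≡ y → z ≡ w → u ≡ v →
  e - f ≡ a * (x - y) + b * (z - w) + c * (u - v) → e ≡ f
combineℚ₃ a b c {x} {z = z} {u = u} refl refl refl id = p-q≡0⇒p≡q (trans id (id′ a b c x z u))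
  where
  id′ : ∀ a b c x z u → a * (x - x) + b * (z - z) + c * (u - u) ≡ 0ℚ
  id′ = solve-∀ ℚ-ring

fromℚ-cong : ∀ {p q} → p ≡ q → fromℚ p ≃ fromℚ q
fromℚ-cong {p} refl = by-identity λ _ → ℚ.+-inverseʳ p

inverse : ∀ {p} → p ≢ 0ℚ → ∃[ w ] w * p ≡ 1ℚ
inverse {p} p≢0 = (1/ p) {{ℚ.≢-nonZero p≢0}} , ℚ.*-inverseˡ p {{ℚ.≢-nonZero p≢0}}

p*q≡0⇒q≡0 : ∀ {p q} → p * q ≡ 0ℚ → p ≢ 0ℚ → q ≡ 0ℚ
p*q≡0⇒q≡0 {p} {q} pq≡0 p≢0 with w , wp≡1 ← inverse p≢0 =
  combineℚ₂ w (- q) pq≡0 wp≡1 (id p q w)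
  where
  id : ∀ p q w → q - 0ℚ ≡ w * (p * q - 0ℚ) + - q * (w * p - 1ℚ)
  id = solve-∀ ℚ-ring

p*p≡0⇒p≡0 : ∀ {p} → p * p ≡ 0ℚ → p ≡ 0ℚ
p*p≡0⇒p≡0 {p} pp≡0 = decidable-stable (p ℚ.≟ 0ℚ) λ p≢0 → p≢0 (p*q≡0⇒q≡0 pp≡0 p≢0)

1≢0 : 1ℚ ≢ 0ℚ
1≢0 ()

affine : ℚ → ℚ → ℝ → ℝ
affine a₀ a₁ t = fromℚ a₀ ⊕ fromℚ a₁ ⊗ t

quadratic : ℚ → ℚ → ℚ → ℝ → ℝ
quadratic a₀ a₁ a₂ t = fromℚ a₀ ⊕ fromℚ a₁ ⊗ t ⊕ fromℚ a₂ ⊗ (t ⊗ t)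

cubic : ℚ → ℚ → ℚ → ℝ → ℝ
cubic A B C t = t ⊗ t ⊗ t ⊕ fromℚ A ⊗ (t ⊗ t) ⊕ fromℚ B ⊗ t ⊕ fromℚ C

cubicℚ : ℚ → ℚ → ℚ → ℚ → ℚ
cubicℚ A B C r = r * r * r + A * (r * r) + B * r + C

Irrational : ℝ → Set
Irrational t = ∀ r → t ≄ fromℚ r

affine-independent : ∀ {a₀ a₁ t} → Irrational t → affine a₀ a₁ t ≃ 0ℝ → a₀ ≡ 0ℚ × a₁ ≡ 0ℚ
affine-independent {a₀} {a₁} {t} t-irr eq with a₁ ℚ.≟ 0ℚ
... | yes a₁≡0 = fromℚ≃0⇒≡0 (combine₂ 1ℝ (fromℚ (- 1ℚ) ⊗ t) eq (fromℚ-cong a₁≡0) λ i → id a₀ a₁ (seq t i)) , a₁≡0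
  where
  id : ∀ a₀ a₁ t → a₀ - 0ℚ ≡ 1ℚ * (a₀ + a₁ * t - 0ℚ) + - 1ℚ * t * (a₁ - 0ℚ)
  id = solve-∀ ℚ-ring
... | no a₁≢0 with w , wa₁≡1 ← inverse a₁≢0 = ⊥-elim (t-irr (- (w * a₀))
    (combine₂ (fromℚ w) (fromℚ (- 1ℚ) ⊗ t) eq (fromℚ-cong wa₁≡1) λ i → id a₀ a₁ w (seq t i)))
  where
  id : ∀ a₀ a₁ w t → t - - (w * a₀) ≡ w * (a₀ + a₁ * t - 0ℚ) + - 1ℚ * t * (w * a₁ - 1ℚ)
  id = solve-∀ ℚ-ring

NoRationalRoot : ℚ → ℚ → ℚ → Set
NoRationalRoot A B C = ∀ r → cubicℚ A B C r ≢ 0ℚ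

-- A cubic without rational roots is the minimal polynomial of each of its real roots.
module CubicIrrational {A B C : ℚ} (noRoot : NoRationalRoot A B C)
                       {t : ℝ} (root : cubic A B C t ≃ 0ℝ) where

  irrational : Irrational t
  irrational r t≃r = noRoot r (fromℚ≃0⇒≡0
    (combine₂ 1ℝ (fromℚ (- 1ℚ) ⊗ (t ⊗ t ⊕ t ⊗ fromℚ r ⊕ fromℚ (r * r) ⊕ fromℚ A ⊗ (t ⊕ fromℚ r) ⊕ fromℚ B))
      root t≃r λ i → id A B C r (seq t i)))
    where
    id : ∀ A B C r t → r * r * r + A * (r * r) + B * r + C - 0ℚ ≡
      1ℚ * (t * t * t + A * (t * t) + B * t + C - 0ℚ)
        + - 1ℚ * (t * t + t * r + r * r + A * (t + r) + B) * (t - r)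
    id = solve-∀ ℚ-ring

  -- The remainder r₁ t + r₀ of the cubic modulo t² + β t + γ, with quotient t + δ.
  module Remainder (β γ : ℚ) where
    δ r₁ r₀ : ℚ
    δ  = A - β
    r₁ = B - γ - β * δ
    r₀ = C - γ * δ

    -- A zero remainder would split off the linear factor t + δ, with the rational root - δ.
    remainder≢0 : r₁ ≡ 0ℚ → r₀ ≡ 0ℚ → ⊥
    remainder≢0 r₁≡0 r₀≡0 = noRoot (- δ) (combineℚ₂ (- δ) 1ℚ r₁≡0 r₀≡0 (id A B C β γ))
      where
      id : ∀ A B C β γ →
        - (A - β) * - (A - β) * - (A - β) + A * (- (A - β) * - (A - β)) + B * - (A - β) + C - 0ℚ ≡
        - (A - β) * (B - γ - β * (A - β) - 0ℚ) + 1ℚ * (C - γ * (A - β) - 0ℚ)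
      id = solve-∀ ℚ-ring

  -- Dividing the cubic by the relation, made monic, leaves a remainder of degree at most one that
  -- vanishes at t. Irrationality makes its coefficients zero, which `remainder≢0` excludes.
  quadratic-independent : ∀ {a₀ a₁ a₂} → quadratic a₀ a₁ a₂ t ≃ 0ℝ →
    a₀ ≡ 0ℚ × a₁ ≡ 0ℚ × a₂ ≡ 0ℚ
  quadratic-independent {a₀} {a₁} {a₂} eq with a₂ ℚ.≟ 0ℚ
  ... | yes a₂≡0 = proj₁ zeros , proj₂ zeros , a₂≡0
    where
    id : ∀ a₀ a₁ a₂ t → a₀ + a₁ * t - 0ℚ ≡
      1ℚ * (a₀ + a₁ * t + a₂ * (t * t) - 0ℚ) + - 1ℚ * (t * t) * (a₂ - 0ℚ)
    id = solve-∀ ℚ-ring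
    zeros : a₀ ≡ 0ℚ × a₁ ≡ 0ℚ
    zeros = affine-independent {t = t} irrational
      (combine₂ 1ℝ (fromℚ (- 1ℚ) ⊗ (t ⊗ t)) eq (fromℚ-cong a₂≡0) λ i → id a₀ a₁ a₂ (seq t i))
  ... | no a₂≢0 with w , wa₂≡1 ← inverse a₂≢0 = ⊥-elim (remainder≢0 (proj₂ zeros) (proj₁ zeros))
    where
    open Remainder (w * a₁) (w * a₀)
    id : ∀ A B C a₀ a₁ a₂ w t →
      (C - w * a₀ * (A - w * a₁)) + (B - w * a₀ - w * a₁ * (A - w * a₁)) * t - 0ℚ ≡
      1ℚ * (t * t * t + A * (t * t) + B * t + C - 0ℚ)
        + - w * (t + (A - w * a₁)) * (a₀ + a₁ * t + a₂ * (t * t) - 0ℚ)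
        + (t + (A - w * a₁)) * (t * t) * (w * a₂ - 1ℚ)
    id = solve-∀ ℚ-ring
    zeros : r₀ ≡ 0ℚ × r₁ ≡ 0ℚ
    zeros = affine-independent {t = t} irrational
      (combine₃ 1ℝ (fromℚ (- w) ⊗ (t ⊕ fromℚ δ)) ((t ⊕ fromℚ δ) ⊗ (t ⊗ t))
        root eq (fromℚ-cong wa₂≡1) λ i → id A B C a₀ a₁ a₂ w (seq t i))

  -- The span of 1, t, t² is the whole field ℚ(t), as t has degree 3.
  InField : ℝ → Set
  InField x = ∃[ e₀ ] ∃[ e₁ ] ∃[ e₂ ] x ≃ quadratic e₀ e₁ e₂ t

  inField-resp : ∀ {x y} → y ≃ x → InField x → InField y
  inField-resp {x} {y} y≃x (e₀ , e₁ , e₂ , eq) = e₀ , e₁ , e₂ ,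
    combine₂ 1ℝ 1ℝ y≃x eq λ i → id (seq x i) (seq y i) (seq (quadratic e₀ e₁ e₂ t) i)
    where
    id : ∀ x y e → y - e ≡ 1ℚ * (y - x) + 1ℚ * (x - e)
    id = solve-∀ ℚ-ring

  inField-⊕ : ∀ {x y} → InField x → InField y → InField (x ⊕ y)
  inField-⊕ {x} {y} (d₀ , d₁ , d₂ , p) (e₀ , e₁ , e₂ , q) = d₀ + e₀ , d₁ + e₁ , d₂ + e₂ ,
    combine₂ 1ℝ 1ℝ p q λ i → id (seq x i) (seq y i) d₀ d₁ d₂ e₀ e₁ e₂ (seq t i)
    where
    id : ∀ x y d₀ d₁ d₂ e₀ e₁ e₂ t → x + y - (d₀ + e₀ + (d₁ + e₁) * t + (d₂ + e₂) * (t * t)) ≡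
      1ℚ * (x - (d₀ + d₁ * t + d₂ * (t * t))) + 1ℚ * (y - (e₀ + e₁ * t + e₂ * (t * t)))
    id = solve-∀ ℚ-ring

  inField-scale : ∀ k {x} → InField x → InField (fromℚ k ⊗ x)
  inField-scale k {x} (e₀ , e₁ , e₂ , p) = k * e₀ , k * e₁ , k * e₂ ,
    combine₁ (fromℚ k) p λ i → id k (seq x i) e₀ e₁ e₂ (seq t i)
    where
    id : ∀ k x e₀ e₁ e₂ t → k * x - (k * e₀ + k * e₁ * t + k * e₂ * (t * t)) ≡
      k * (x - (e₀ + e₁ * t + e₂ * (t * t)))
    id = solve-∀ ℚ-ring

  inField-generator* : ∀ {x} → InField x → InField (t ⊗ x)
  inField-generator* {x} (e₀ , e₁ , e₂ , p) =
    - (C * e₂) , e₀ - B * e₂ , e₁ - A * e₂ ,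
    combine₂ t (fromℚ e₂) p root λ i → id A B C (seq x i) e₀ e₁ e₂ (seq t i)
    where
    id : ∀ A B C x e₀ e₁ e₂ t →
      t * x - (- (C * e₂) + (e₀ - B * e₂) * t + (e₁ - A * e₂) * (t * t)) ≡
      t * (x - (e₀ + e₁ * t + e₂ * (t * t))) + e₂ * (t * t * t + A * (t * t) + B * t + C - 0ℚ)
    id = solve-∀ ℚ-ring

  -- (t + ρ)(t² + κ t + l) is the cubic plus the non-zero constant n.
  inField-÷linear : ∀ ρ {y} → InField ((t ⊕ fromℚ ρ) ⊗ y) → InField y
  inField-÷linear ρ {y} ty∈ = let w , wn≡1 = inverse n≢0 in
    inField-resp (combine₂ (fromℚ (- w) ⊗ y) (fromℚ (- 1ℚ) ⊗ y) root (fromℚ-cong wn≡1)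
                    λ i → id A B C ρ w (seq y i) (seq t i))
      (inField-scale w
        (inField-⊕ (inField-⊕ (inField-generator* (inField-generator* ty∈))
                              (inField-scale κ (inField-generator* ty∈)))
                   (inField-scale l ty∈)))
    where
    κ l n : ℚ
    κ = A - ρ
    l = B - ρ * κ
    n = ρ * l - C
    idℚ : ∀ A B C ρ → - ρ * - ρ * - ρ + A * (- ρ * - ρ) + B * - ρ + C - 0ℚ ≡
      - 1ℚ * (ρ * (B - ρ * (A - ρ)) - C - 0ℚ)
    idℚ = solve-∀ ℚ-ring
    n≢0 : n ≢ 0ℚ
    n≢0 n≡0 = noRoot (- ρ) (combineℚ₁ (- 1ℚ) n≡0 (idℚ A B C ρ))
    id : ∀ A B C ρ w y t →
      y - w * (t * (t * ((t + ρ) * y)) + (A - ρ) * (t * ((t + ρ) * y)) + (B - ρ * (A - ρ)) * ((t + ρ) * y)) ≡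
      - w * y * (t * t * t + A * (t * t) + B * t + C - 0ℚ)
        + - 1ℚ * y * (w * (ρ * (B - ρ * (A - ρ)) - C) - 1ℚ)
    id = solve-∀ ℚ-ring

  -- One Euclidean step: multiplication by t + δ turns the divisor into minus the remainder r₁ t +
  -- r₀. This is not zero, so only a linear factor or a constant is left to cancel.
  inField-÷monic : ∀ β γ {y} → InField (quadratic γ β 1ℚ t ⊗ y) → InField y
  inField-÷monic β γ {y} qy∈ = case (r₁ ℚ.≟ 0ℚ)
    where
    open Remainder β γ
    -- X ≃ - (r₁ t + r₀) y
    X : ℝ
    X = t ⊗ (quadratic γ β 1ℚ t ⊗ y) ⊕ fromℚ δ ⊗ (quadratic γ β 1ℚ t ⊗ y)
    X∈ : InField X
    X∈ = inField-⊕ (inField-generator* qy∈) (inField-scale δ qy∈)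
    id₁ : ∀ A B C β γ w y t →
      (t + w * (C - γ * (A - β))) * y
        - - w * (t * ((γ + β * t + 1ℚ * (t * t)) * y) + (A - β) * ((γ + β * t + 1ℚ * (t * t)) * y)) ≡
      w * y * (t * t * t + A * (t * t) + B * t + C - 0ℚ)
        + - 1ℚ * (t * y) * (w * (B - γ - β * (A - β)) - 1ℚ)
    id₁ = solve-∀ ℚ-ring
    id₀ : ∀ A B C β γ w y t →
      y - - w * (t * ((γ + β * t + 1ℚ * (t * t)) * y) + (A - β) * ((γ + β * t + 1ℚ * (t * t)) * y)) ≡
      w * y * (t * t * t + A * (t * t) + B * t + C - 0ℚ)
        + - w * (t * y) * ((B - γ - β * (A - β)) - 0ℚ)
        + - 1ℚ * y * (w * (C - γ * (A - β)) - 1ℚ)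
    id₀ = solve-∀ ℚ-ring
    linear : ∃[ w ] w * r₁ ≡ 1ℚ → InField y
    linear (w , wr₁≡1) = inField-÷linear (w * r₀) {y}
      (inField-resp {fromℚ (- w) ⊗ X} {(t ⊕ fromℚ (w * r₀)) ⊗ y}
        (combine₂ (fromℚ w ⊗ y) (fromℚ (- 1ℚ) ⊗ (t ⊗ y)) root (fromℚ-cong wr₁≡1)
          λ i → id₁ A B C β γ w (seq y i) (seq t i))
        (inField-scale (- w) {X} X∈))
    constant : r₁ ≡ 0ℚ → ∃[ w ] w * r₀ ≡ 1ℚ → InField y
    constant r₁≡0 (w , wr₀≡1) = inField-resp {fromℚ (- w) ⊗ X} {y}
      (combine₃ (fromℚ w ⊗ y) (fromℚ (- w) ⊗ (t ⊗ y)) (fromℚ (- 1ℚ) ⊗ y)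
        root (fromℚ-cong r₁≡0) (fromℚ-cong wr₀≡1)
        λ i → id₀ A B C β γ w (seq y i) (seq t i))
      (inField-scale (- w) {X} X∈)
    case : Dec (r₁ ≡ 0ℚ) → InField y
    case (no r₁≢0)  = linear (inverse r₁≢0)
    case (yes r₁≡0) = constant r₁≡0 (inverse (remainder≢0 r₁≡0))

  inField-÷ : ∀ {o₀ o₁ o₂ y} → ¬ (o₀ ≡ 0ℚ × o₁ ≡ 0ℚ × o₂ ≡ 0ℚ) →
    InField (quadratic o₀ o₁ o₂ t ⊗ y) → InField y
  inField-÷ {o₀} {o₁} {o₂} {y} o≢0 oy∈ with o₂ ℚ.≟ 0ℚ
  ... | no o₂≢0 with w , wo₂≡1 ← inverse o₂≢0 = inField-÷monic (w * o₁) (w * o₀)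
    (inField-resp (combine₁ (fromℚ (- 1ℚ) ⊗ (t ⊗ t ⊗ y)) (fromℚ-cong wo₂≡1)
                     λ i → id o₀ o₁ o₂ w (seq y i) (seq t i))
      (inField-scale w oy∈))
    where
    id : ∀ o₀ o₁ o₂ w y t →
      (w * o₀ + w * o₁ * t + 1ℚ * (t * t)) * y - w * ((o₀ + o₁ * t + o₂ * (t * t)) * y) ≡
      - 1ℚ * (t * t * y) * (w * o₂ - 1ℚ)
    id = solve-∀ ℚ-ring
  ... | yes o₂≡0 with o₁ ℚ.≟ 0ℚ
  ...   | no o₁≢0 with w , wo₁≡1 ← inverse o₁≢0 = inField-÷linear (w * o₀)
    (inField-resp (combine₂ (fromℚ (- 1ℚ) ⊗ (t ⊗ y)) (fromℚ (- w) ⊗ (t ⊗ t ⊗ y))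
                     (fromℚ-cong wo₁≡1) (fromℚ-cong o₂≡0)
                     λ i → id o₀ o₁ o₂ w (seq y i) (seq t i))
      (inField-scale w oy∈))
    where
    id : ∀ o₀ o₁ o₂ w y t →
      (t + w * o₀) * y - w * ((o₀ + o₁ * t + o₂ * (t * t)) * y) ≡
      - 1ℚ * (t * y) * (w * o₁ - 1ℚ) + - w * (t * t * y) * (o₂ - 0ℚ)
    id = solve-∀ ℚ-ring
  ...   | yes o₁≡0 with w , wo₀≡1 ← inverse (λ o₀≡0 → o≢0 (o₀≡0 , o₁≡0 , o₂≡0)) =
    inField-resp (combine₃ (fromℚ (- 1ℚ) ⊗ y) (fromℚ (- w) ⊗ (t ⊗ y)) (fromℚ (- w) ⊗ (t ⊗ t ⊗ y))
                     (fromℚ-cong wo₀≡1) (fromℚ-cong o₁≡0) (fromℚ-cong o₂≡0)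
                     λ i → id o₀ o₁ o₂ w (seq y i) (seq t i))
      (inField-scale w oy∈)
    where
    id : ∀ o₀ o₁ o₂ w y t →
      y - w * ((o₀ + o₁ * t + o₂ * (t * t)) * y) ≡
      - 1ℚ * y * (w * o₀ - 1ℚ) + - w * (t * y) * (o₁ - 0ℚ) + - w * (t * t * y) * (o₂ - 0ℚ)
    id = solve-∀ ℚ-ring

-- IsNorm A B C: with g = x³ + a x² + b x + d, the polynomial - g(x) g(-x) is
-- the cubic with coefficients A, B, C evaluated at x².
data IsNorm : ℚ → ℚ → ℚ → Set where
  norm : ∀ a b d → IsNorm ((1ℚ + 1ℚ) * b - a * a) (b * b - (1ℚ + 1ℚ) * a * d) (- (d * d))

isNorm : ∀ {A B C} a b d → (1ℚ + 1ℚ) * b - a * a ≡ A → b * b - (1ℚ + 1ℚ) * a * d ≡ B →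
  - (d * d) ≡ C → IsNorm A B C
isNorm a b d refl refl refl = norm a b d

-- If √t lies in ℚ(t), then it has degree 3 over ℚ, and the minimal polynomial
-- of t is the norm of that of √t.
module SquareRoot {A B C : ℚ} (noRoot : NoRationalRoot A B C)
                  {μ : ℝ} (root : cubic A B C (μ ⊗ μ) ≃ 0ℝ) where

  open CubicIrrational {A} {B} {C} noRoot {μ ⊗ μ} root

  inField⇒isNorm : InField μ → IsNorm A B C
  inField⇒isNorm (e₀ , e₁ , e₂ , μ≃e) = case (e₂ ℚ.≟ 0ℚ)
    where
    z : ℝ
    z = μ ⊗ μ
    case : _ → IsNorm A B C
    case (yes e₂≡0) = ⊥-elim (1≢0 (combineℚ₂ ((1ℚ + 1ℚ) * e₀) (- 1ℚ) e₁≡0 (proj₁ (proj₂ zeros)) (idℚ e₀ e₁)))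
      where
      id : ∀ e₀ e₁ e₂ μ →
        e₀ * e₀ + ((1ℚ + 1ℚ) * e₀ * e₁ - 1ℚ) * (μ * μ) + e₁ * e₁ * (μ * μ * (μ * μ)) - 0ℚ ≡
        - 1ℚ * (e₀ + e₁ * (μ * μ) + μ) * (μ - (e₀ + e₁ * (μ * μ) + e₂ * (μ * μ * (μ * μ))))
          + - 1ℚ * (e₀ + e₁ * (μ * μ) + μ) * (μ * μ * (μ * μ)) * (e₂ - 0ℚ)
      id = solve-∀ ℚ-ring
      idℚ : ∀ e₀ e₁ → 1ℚ - 0ℚ ≡ (1ℚ + 1ℚ) * e₀ * (e₁ - 0ℚ) + - 1ℚ * ((1ℚ + 1ℚ) * e₀ * e₁ - 1ℚ - 0ℚ)
      idℚ = solve-∀ ℚ-ring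
      -- Here z = μ² = (e₀ + e₁ z)². Comparing coefficients over 1, z, z² gives both e₁² = 0 and 2
      -- e₀ e₁ = 1.
      zeros : e₀ * e₀ ≡ 0ℚ × (1ℚ + 1ℚ) * e₀ * e₁ - 1ℚ ≡ 0ℚ × e₁ * e₁ ≡ 0ℚ
      zeros = quadratic-independent
        (combine₂ (fromℚ (- 1ℚ) ⊗ (affine e₀ e₁ z ⊕ μ)) (fromℚ (- 1ℚ) ⊗ (affine e₀ e₁ z ⊕ μ) ⊗ (z ⊗ z))
          μ≃e (fromℚ-cong e₂≡0) λ i → id e₀ e₁ e₂ (seq μ i))
      e₁≡0 : e₁ ≡ 0ℚ
      e₁≡0 = p*p≡0⇒p≡0 (proj₂ (proj₂ zeros))
    case (no e₂≢0) with w , we₂≡1 ← inverse e₂≢0 = use zeros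
      where
      -- Chosen so that the z²-coefficient of μ (z + b) vanishes.
      b a d : ℚ
      b = A - w * e₁
      a = B * e₂ - e₀ - b * e₁
      d = C * e₂ - b * e₀
      id : ∀ A B C e₀ e₁ e₂ w μ →
        μ * (μ * μ + (A - w * e₁)) + ((B * e₂ - e₀ - (A - w * e₁) * e₁) * (μ * μ) + (C * e₂ - (A - w * e₁) * e₀)) - 0ℚ ≡
        (μ * μ + (A - w * e₁)) * (μ - (e₀ + e₁ * (μ * μ) + e₂ * (μ * μ * (μ * μ))))
          + e₂ * (μ * μ * (μ * μ) * (μ * μ) + A * (μ * μ * (μ * μ)) + B * (μ * μ) + C - 0ℚ)
          + - e₁ * (μ * μ * (μ * μ)) * (w * e₂ - 1ℚ)
      id = solve-∀ ℚ-ring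
      -- This is g(μ) = 0 for g = x³ + a x² + b x + d, with odd and even parts grouped; a and d are
      -- minus the coefficients left in μ (z + b) after reduction modulo the cubic.
      relation : μ ⊗ (z ⊕ fromℚ b) ⊕ (fromℚ a ⊗ z ⊕ fromℚ d) ≃ 0ℝ
      relation = combine₃ (z ⊕ fromℚ b) (fromℚ e₂) (fromℚ (- e₁) ⊗ (z ⊗ z))
        μ≃e root (fromℚ-cong we₂≡1) λ i → id A B C e₀ e₁ e₂ w (seq μ i)
      id′ : ∀ A B C a b d μ →
        - (d * d) - C + (b * b - (1ℚ + 1ℚ) * a * d - B) * (μ * μ)
          + ((1ℚ + 1ℚ) * b - a * a - A) * (μ * μ * (μ * μ)) - 0ℚ ≡
        (μ * (μ * μ + b) + - 1ℚ * (a * (μ * μ) + d)) * (μ * (μ * μ + b) + (a * (μ * μ) + d) - 0ℚ)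
          + - 1ℚ * (μ * μ * (μ * μ) * (μ * μ) + A * (μ * μ * (μ * μ)) + B * (μ * μ) + C - 0ℚ)
      id′ = solve-∀ ℚ-ring
      -- Multiplied by its conjugate, `relation` becomes z (z + b)² - (a z + d)² = 0. This cubic in
      -- z is monic, so its difference from the given one has degree at most 2 and must vanish
      -- identically.
      zeros : - (d * d) - C ≡ 0ℚ × b * b - (1ℚ + 1ℚ) * a * d - B ≡ 0ℚ × (1ℚ + 1ℚ) * b - a * a - A ≡ 0ℚ
      zeros = quadratic-independent
        (combine₂ (μ ⊗ (z ⊕ fromℚ b) ⊕ fromℚ (- 1ℚ) ⊗ (fromℚ a ⊗ z ⊕ fromℚ d)) (fromℚ (- 1ℚ))
          relation root λ i → id′ A B C a b d (seq μ i))
      use : _ → IsNorm A B C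
      use (pC , pB , pA) = isNorm a b d (p-q≡0⇒p≡q pA) (p-q≡0⇒p≡q pB) (p-q≡0⇒p≡q pC)

-- Conjugate roots of a cubic

square-nonNegative : ∀ p → 0ℚ ℚ.≤ p * p
square-nonNegative p with ℚ.≤-total 0ℚ p
... | inj₁ 0≤p = ℚ.nonNegative⁻¹ (p * p) {{ℚ.nonNeg*nonNeg⇒nonNeg p {{ℚ.nonNegative 0≤p}} p {{ℚ.nonNegative 0≤p}}}}
... | inj₂ p≤0 = ℚ.nonNegative⁻¹ (p * p) {{ℚ.nonPos*nonPos⇒nonPos p {{ℚ.nonPositive p≤0}} p {{ℚ.nonPositive p≤0}}}}

square+positive≢0 : ∀ p {k} → 0ℚ ℚ.< k → p * p + k ≢ 0ℚ
square+positive≢0 p {k} 0<k eq = ℚ.<-irrefl (sym eq) (ℚ.+-mono-≤-< (square-nonNegative p) 0<k)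

p²+q²≡0⇒p≡0 : ∀ {p q} → p * p + q * q ≡ 0ℚ → p ≡ 0ℚ
p²+q²≡0⇒p≡0 {p} {q} eq = decidable-stable (p ℚ.≟ 0ℚ) λ p≢0 →
  let w , wp≡1 = inverse p≢0 in
  square+positive≢0 (w * q) (ℚ.positive⁻¹ 1ℚ)
    (combineℚ₂ (w * w) (- (w * p + 1ℚ)) eq wp≡1 (id p q w))
  where
  id : ∀ p q w → w * q * (w * q) + 1ℚ - 0ℚ ≡
    w * w * (p * p + q * q - 0ℚ) + - (w * p + 1ℚ) * (w * p - 1ℚ)
  id = solve-∀ ℚ-ring

-- Four times the expression is (2 s + 1)² + 3. There is thus no rational cube root of unity other
-- than 1.
1+s+s²≢0 : ∀ s → 1ℚ + s + s * s ≢ 0ℚ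
1+s+s²≢0 s eq = square+positive≢0 ((1ℚ + 1ℚ) * s + 1ℚ) (ℚ.positive⁻¹ (1ℚ + 1ℚ + 1ℚ))
  (combineℚ₁ (1ℚ + 1ℚ + 1ℚ + 1ℚ) eq (id s))
  where
  id : ∀ s → ((1ℚ + 1ℚ) * s + 1ℚ) * ((1ℚ + 1ℚ) * s + 1ℚ) + (1ℚ + 1ℚ + 1ℚ) - 0ℚ ≡
    (1ℚ + 1ℚ + 1ℚ + 1ℚ) * (1ℚ + s + s * s - 0ℚ)
  id = solve-∀ ℚ-ring

minus : ℝ → ℝ → ℝ
minus x y = x ⊕ fromℚ (- 1ℚ) ⊗ y

≄⇒difference≄0 : ∀ {x y} → x ≄ y → minus x y ≄ 0ℝ
≄⇒difference≄0 {x} {y} x≄y eq = x≄y (combine₁ 1ℝ eq λ i → id (seq x i) (seq y i))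
  where
  id : ∀ x y → x - y ≡ 1ℚ * (x + - 1ℚ * y - 0ℚ)
  id = solve-∀ ℚ-ring

module ConjugateRoots {a b d : ℚ} (noRoot : NoRationalRoot a b d) where

  affine-conjugate : ∀ {x y} → cubic a b d x ≃ 0ℝ → cubic a b d y ≃ 0ℝ →
    ∀ p s → y ≃ affine p s x → y ≃ x
  affine-conjugate {x} {y} gx gy p s y≃ = combine₃ 1ℝ 1ℝ x y≃ (fromℚ-cong p≡0) (fromℚ-cong s≡1)
      λ i → id₆ p s (seq x i) (seq y i)
    where
    open CubicIrrational {a} {b} {d} noRoot {x} gx
    3ℚ third u e₀ e₁ e₂ : ℚ
    3ℚ = 1ℚ + 1ℚ + 1ℚ
    third = + 1 ℚ./ 3
    u  = - (third * a)
    e₀ = p * p * p + a * (p * p) + b * p + d - s * s * s * d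
    e₁ = 3ℚ * p * p * s + (1ℚ + 1ℚ) * a * p * s + b * s - s * s * s * b
    e₂ = s * s * (3ℚ * p + a - s * a)
    id₁ : ∀ a b d p s x y →
      p * p * p + a * (p * p) + b * p + d - s * s * s * d
        + ((1ℚ + 1ℚ + 1ℚ) * p * p * s + (1ℚ + 1ℚ) * a * p * s + b * s - s * s * s * b) * x
        + s * s * ((1ℚ + 1ℚ + 1ℚ) * p + a - s * a) * (x * x) - 0ℚ ≡
      1ℚ * (y * y * y + a * (y * y) + b * y + d - 0ℚ)
        + - 1ℚ * (y * y + y * (p + s * x) + (p + s * x) * (p + s * x) + a * (y + (p + s * x)) + b)
            * (y - (p + s * x))
        + - (s * s * s) * (x * x * x + a * (x * x) + b * x + d - 0ℚ)
    id₁ = solve-∀ ℚ-ring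
    -- The coefficients of g(p + s x) - s³ g(x), of degree 2 in x.
    zeros : e₀ ≡ 0ℚ × e₁ ≡ 0ℚ × e₂ ≡ 0ℚ
    zeros = quadratic-independent
      (combine₃ 1ℝ
        (fromℚ (- 1ℚ) ⊗ (y ⊗ y ⊕ y ⊗ affine p s x ⊕ affine p s x ⊗ affine p s x
          ⊕ fromℚ a ⊗ (y ⊕ affine p s x) ⊕ fromℚ b))
        (fromℚ (- (s * s * s))) gy y≃ gx λ i → id₁ a b d p s (seq x i) (seq y i))
    id₂ : ∀ a b d p s → p * p * p + a * (p * p) + b * p + d - 0ℚ ≡
      1ℚ * (p * p * p + a * (p * p) + b * p + d - s * s * s * d - 0ℚ) + s * s * d * (s - 0ℚ)
    id₂ = solve-∀ ℚ-ring
    s≢0 : s ≢ 0ℚ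
    s≢0 s≡0 = noRoot p (combineℚ₂ 1ℚ (s * s * d) (proj₁ zeros) s≡0 (id₂ a b d p s))
    translation≡0 : 3ℚ * p + a - s * a ≡ 0ℚ
    translation≡0 = p*q≡0⇒q≡0 (proj₂ (proj₂ zeros)) λ ss≡0 → s≢0 (p*p≡0⇒p≡0 ss≡0)
    id₃ : ∀ a p s → p + s * - (+ 1 ℚ./ 3 * a) - - (+ 1 ℚ./ 3 * a) ≡ + 1 ℚ./ 3 * ((1ℚ + 1ℚ + 1ℚ) * p + a - s * a - 0ℚ)
    id₃ = solve-∀ ℚ-ring
    -- The affine map x ↦ p + s x fixes the centre u of the roots.
    fixed : p + s * u ≡ u
    fixed = combineℚ₁ third translation≡0 (id₃ a p s)
    id₄ : ∀ a b d p s u →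
      (p + s * u) * (p + s * u) * (p + s * u) + a * ((p + s * u) * (p + s * u)) + b * (p + s * u) + d
        - s * s * s * (u * u * u + a * (u * u) + b * u + d) ≡
      1ℚ * (p * p * p + a * (p * p) + b * p + d - s * s * s * d - 0ℚ)
        + u * ((1ℚ + 1ℚ + 1ℚ) * p * p * s + (1ℚ + 1ℚ) * a * p * s + b * s - s * s * s * b - 0ℚ)
        + u * u * (s * s * ((1ℚ + 1ℚ + 1ℚ) * p + a - s * a) - 0ℚ)
    id₄ = solve-∀ ℚ-ring
    -- The identity g(p + s X) = s³ g(X) at the fixed point X = u. Since u is rational, g(u) is not
    -- 0, and s³ = 1 follows.
    scaled : cubicℚ a b d u ≡ s * s * s * cubicℚ a b d u
    scaled = trans (cong (cubicℚ a b d) (sym fixed))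
      (combineℚ₃ 1ℚ u (u * u) (proj₁ zeros) (proj₁ (proj₂ zeros)) (proj₂ (proj₂ zeros)) (id₄ a b d p s u))
    id₅ : ∀ g s → g * ((1ℚ + s + s * s) * (1ℚ - s)) - 0ℚ ≡ 1ℚ * (g - s * s * s * g)
    id₅ = solve-∀ ℚ-ring
    s≡1 : s ≡ 1ℚ
    s≡1 = sym (p-q≡0⇒p≡q (p*q≡0⇒q≡0 (p*q≡0⇒q≡0 (combineℚ₁ 1ℚ scaled (id₅ (cubicℚ a b d u) s)) (noRoot u)) (1+s+s²≢0 s)))
    id₇ : ∀ a p s → p - 0ℚ ≡ + 1 ℚ./ 3 * ((1ℚ + 1ℚ + 1ℚ) * p + a - s * a - 0ℚ) + + 1 ℚ./ 3 * a * (s - 1ℚ)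
    id₇ = solve-∀ ℚ-ring
    p≡0 : p ≡ 0ℚ
    p≡0 = combineℚ₂ third (third * a) translation≡0 s≡1 (id₇ a p s)
    id₆ : ∀ p s x y → y - x ≡ 1ℚ * (y - (p + s * x)) + 1ℚ * (p - 0ℚ) + x * (s - 1ℚ)
    id₆ = solve-∀ ℚ-ring

  independent₂ : ∀ {x y} → cubic a b d x ≃ 0ℝ → cubic a b d y ≃ 0ℝ → x ≄ y →
    ∀ {c₀ c₁ c₂} → fromℚ c₀ ⊕ fromℚ c₁ ⊗ x ⊕ fromℚ c₂ ⊗ y ≃ 0ℝ →
    c₀ ≡ 0ℚ × c₁ ≡ 0ℚ × c₂ ≡ 0ℚ
  independent₂ {x} {y} gx gy x≄y {c₀} {c₁} {c₂} eq with c₂ ℚ.≟ 0ℚ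
  ... | yes c₂≡0 = proj₁ zeros , proj₂ zeros , c₂≡0
    where
    id : ∀ c₀ c₁ c₂ x y → c₀ + c₁ * x - 0ℚ ≡ 1ℚ * (c₀ + c₁ * x + c₂ * y - 0ℚ) + - 1ℚ * y * (c₂ - 0ℚ)
    id = solve-∀ ℚ-ring
    zeros : c₀ ≡ 0ℚ × c₁ ≡ 0ℚ
    zeros = affine-independent {t = x} (CubicIrrational.irrational {a} {b} {d} noRoot {x} gx)
      (combine₂ 1ℝ (fromℚ (- 1ℚ) ⊗ y) eq (fromℚ-cong c₂≡0) λ i → id c₀ c₁ c₂ (seq x i) (seq y i))
  ... | no c₂≢0 = ⊥-elim (let w , wc₂≡1 = inverse c₂≢0 in x≄y (≃-sym (affine-conjugate gx gy (- (w * c₀)) (- (w * c₁))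
      (combine₂ (fromℚ w) (fromℚ (- 1ℚ) ⊗ y) eq (fromℚ-cong wc₂≡1) λ i → id c₀ c₁ c₂ w (seq x i) (seq y i)))))
    where
    id : ∀ c₀ c₁ c₂ w x y → y - (- (w * c₀) + - (w * c₁) * x) ≡
      w * (c₀ + c₁ * x + c₂ * y - 0ℚ) + - 1ℚ * y * (w * c₂ - 1ℚ)
    id = solve-∀ ℚ-ring

  -- Vieta by divided differences: `slope` is the first one, (g(x) - g(y)) / (x - y), and two slopes
  -- with x in common differ by (y - z) (x + y + z + a).
  sum-of-roots : ∀ {x y z} → cubic a b d x ≃ 0ℝ → cubic a b d y ≃ 0ℝ → cubic a b d z ≃ 0ℝ →
    x ≄ y → x ≄ z → y ≄ z → x ⊕ y ⊕ z ⊕ fromℚ a ≃ 0ℝ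
  sum-of-roots {x} {y} {z} gx gy gz x≄y x≄z y≄z =
    x*y≃0⇒y≃0 (minus y z) (x ⊕ y ⊕ z ⊕ fromℚ a)
      (combine₂ 1ℝ (fromℚ (- 1ℚ)) (slope gx gy x≄y) (slope gx gz x≄z)
        λ i → id a b (seq x i) (seq y i) (seq z i))
      (≄⇒difference≄0 y≄z)
    where
    id′ : ∀ a b d x y →
      (x + - 1ℚ * y) * (x * x + x * y + y * y + a * (x + y) + b) - 0ℚ ≡
      1ℚ * (x * x * x + a * (x * x) + b * x + d - 0ℚ) + - 1ℚ * (y * y * y + a * (y * y) + b * y + d - 0ℚ)
    id′ = solve-∀ ℚ-ring
    slope : ∀ {x y} → cubic a b d x ≃ 0ℝ → cubic a b d y ≃ 0ℝ → x ≄ y →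
      x ⊗ x ⊕ x ⊗ y ⊕ y ⊗ y ⊕ fromℚ a ⊗ (x ⊕ y) ⊕ fromℚ b ≃ 0ℝ
    slope {x} {y} gx gy x≄y = x*y≃0⇒y≃0 (minus x y) _
      (combine₂ 1ℝ (fromℚ (- 1ℚ)) gx gy λ i → id′ a b d (seq x i) (seq y i)) (≄⇒difference≄0 x≄y)
    id : ∀ a b x y z → (y + - 1ℚ * z) * (x + y + z + a) - 0ℚ ≡
      1ℚ * (x * x + x * y + y * y + a * (x + y) + b - 0ℚ)
        + - 1ℚ * (x * x + x * z + z * z + a * (x + z) + b - 0ℚ)
    id = solve-∀ ℚ-ring

  -- Subtracting c₃ times x + y + z + a = 0 eliminates z and leaves the constant term - a c₃, which
  -- `independent₂` forces to vanish.
  independent₃ : a ≢ 0ℚ → ∀ {x y z} →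
    cubic a b d x ≃ 0ℝ → cubic a b d y ≃ 0ℝ → cubic a b d z ≃ 0ℝ → x ≄ y → x ≄ z → y ≄ z →
    ∀ {c₁ c₂ c₃} → fromℚ c₁ ⊗ x ⊕ fromℚ c₂ ⊗ y ⊕ fromℚ c₃ ⊗ z ≃ 0ℝ →
    c₁ ≡ 0ℚ × c₂ ≡ 0ℚ × c₃ ≡ 0ℚ
  independent₃ a≢0 {x} {y} {z} gx gy gz x≄y x≄z y≄z {c₁} {c₂} {c₃} eq =
    trans (p-q≡0⇒p≡q (proj₁ (proj₂ zeros))) c₃≡0 , trans (p-q≡0⇒p≡q (proj₂ (proj₂ zeros))) c₃≡0 , c₃≡0
    where
    id : ∀ a c₁ c₂ c₃ x y z → a * - c₃ + (c₁ - c₃) * x + (c₂ - c₃) * y - 0ℚ ≡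
      1ℚ * (c₁ * x + c₂ * y + c₃ * z - 0ℚ) + - c₃ * (x + y + z + a - 0ℚ)
    id = solve-∀ ℚ-ring
    zeros : a * - c₃ ≡ 0ℚ × c₁ - c₃ ≡ 0ℚ × c₂ - c₃ ≡ 0ℚ
    zeros = independent₂ gx gy x≄y
      (combine₂ 1ℝ (fromℚ (- c₃)) eq (sum-of-roots gx gy gz x≄y x≄z y≄z)
        λ i → id a c₁ c₂ c₃ (seq x i) (seq y i) (seq z i))
    c₃≡0 : c₃ ≡ 0ℚ
    c₃≡0 = combineℚ₁ (- 1ℚ) (p*q≡0⇒q≡0 (proj₁ zeros) a≢0) (id′ c₃)
      where
      id′ : ∀ c → c - 0ℚ ≡ - 1ℚ * (- c - 0ℚ)
      id′ = solve-∀ ℚ-ring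

  -- Next to x and y every further root equals - a - x - y, so z and w would coincide.
  at-most-three : ∀ {x y z w} → cubic a b d x ≃ 0ℝ → cubic a b d y ≃ 0ℝ →
    cubic a b d z ≃ 0ℝ → cubic a b d w ≃ 0ℝ →
    x ≄ y → x ≄ z → y ≄ z → x ≄ w → y ≄ w → z ≄ w → ⊥
  at-most-three {x} {y} {z} {w} gx gy gz gw x≄y x≄z y≄z x≄w y≄w z≄w = z≄w
    (combine₂ 1ℝ (fromℚ (- 1ℚ)) (sum-of-roots gx gy gz x≄y x≄z y≄z) (sum-of-roots gx gy gw x≄y x≄w y≄w)
      λ i → id a (seq x i) (seq y i) (seq z i) (seq w i))
    where
    id : ∀ a x y z w → z - w ≡ 1ℚ * (x + y + z + a - 0ℚ) + - 1ℚ * (x + y + w + a - 0ℚ)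
    id = solve-∀ ℚ-ring

-- Sets that are independent up to one element

module _ {c₁ c₂ : ℚ} where
  zero-pair-stable : ¬ ¬ (c₁ ≡ 0ℚ × c₂ ≡ 0ℚ) → c₁ ≡ 0ℚ × c₂ ≡ 0ℚ
  zero-pair-stable = decidable-stable ((c₁ ℚ.≟ 0ℚ) ×-dec (c₂ ℚ.≟ 0ℚ))

module _ {c₁ c₂ c₃ : ℚ} where
  zero-triple-stable : ¬ ¬ (c₁ ≡ 0ℚ × c₂ ≡ 0ℚ × c₃ ≡ 0ℚ) → c₁ ≡ 0ℚ × c₂ ≡ 0ℚ × c₃ ≡ 0ℚ
  zero-triple-stable = decidable-stable ((c₁ ℚ.≟ 0ℚ) ×-dec ((c₂ ℚ.≟ 0ℚ) ×-dec (c₃ ℚ.≟ 0ℚ)))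

-- Expresses that P has at most four elements and becomes linearly independent
-- when any one of them is removed.
record IndependentUpToOne (P : Pred ℝ 0ℓ) : Set where
  field
    two   : ∀ {x y} → P x → P y → x ≄ y →
            ∀ {c₁ c₂} → fromℚ c₁ ⊗ x ⊕ fromℚ c₂ ⊗ y ≃ 0ℝ → c₁ ≡ 0ℚ × c₂ ≡ 0ℚ
    three : ∀ {w x y z} → P w → P x → P y → P z →
            x ≄ w → y ≄ w → z ≄ w → x ≄ y → x ≄ z → y ≄ z →
            ∀ {c₁ c₂ c₃} → fromℚ c₁ ⊗ x ⊕ fromℚ c₂ ⊗ y ⊕ fromℚ c₃ ⊗ z ≃ 0ℝ →
            c₁ ≡ 0ℚ × c₂ ≡ 0ℚ × c₃ ≡ 0ℚ
    five  : ∀ {v w x y z} → P v → P w → P x → P y → P z →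
            v ≄ w → v ≄ x → v ≄ y → v ≄ z → w ≄ x → w ≄ y → w ≄ z → x ≄ y → x ≄ z → y ≄ z → ⊥

square-injective : ∀ {x y} → 0ℝ < x → 0ℝ < y → x ≄ y → x ⊗ x ≄ y ⊗ y
square-injective {x} {y} 0<x 0<y x≄y xx≃yy = ≄⇒difference≄0 x≄y
  (x*y≃0⇒y≃0 (x ⊕ y) (minus x y) (combine₁ 1ℝ xx≃yy λ i → id (seq x i) (seq y i))
    (positive⇒≄0 (+-positive {x} {y} 0<x 0<y)))
  where
  id : ∀ x y → (x + y) * (x + - 1ℚ * y) - 0ℚ ≡ 1ℚ * (x * x - y * y)
  id = solve-∀ ℚ-ring

singleton-independentUpToOne : ∀ {P} → (∀ {x} → P x → ¬ ¬ (x ≃ 1ℝ)) → IndependentUpToOne P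
singleton-independentUpToOne {P} one = record
  { two   = λ Px Py x≄y → ⊥-elim (equal Px Py x≄y)
  ; three = λ Pw Px _ _ x≄w → ⊥-elim (equal Px Pw x≄w)
  ; five  = λ Pv Pw _ _ _ v≄w → ⊥-elim (equal Pv Pw v≄w)
  }
  where
  equal : ∀ {x y} → P x → P y → ¬ (x ≄ y)
  equal Px Py x≄y = one Px λ x≃1 → one Py λ y≃1 → x≄y (≃-trans x≃1 (≃-sym y≃1))

-- The disjunction of x ≃ 1 and f x ≃ 0 cannot be decided; the implication is the form of it that an
-- eigenvector yields constructively.
record PositiveRootOrOne (f : ℝ → ℝ) (x : ℝ) : Set where
  constructor _,_
  field
    positive : 0ℝ < x
    vanishes : x ≄ 1ℝ → f x ≃ 0ℝ

-- Square roots of the roots of y² - N y + 1, for the case lm = 0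

module ReciprocalQuadratic (N : ℚ) (noRoot : ∀ r → r * r - N * r + 1ℚ ≢ 0ℚ) where

  Candidate : Pred ℝ 0ℓ
  Candidate = PositiveRootOrOne (λ x → quadratic 1ℚ (- N) 1ℚ (x ⊗ x))

  record Root (x : ℝ) : Set where
    constructor _,_
    field
      positive : 0ℝ < x
      vanishes : quadratic 1ℚ (- N) 1ℚ (x ⊗ x) ≃ 0ℝ

  open Root

  root-irrational : ∀ {x} → Root x → Irrational (x ⊗ x)
  root-irrational {x} gx r eq = noRoot r (fromℚ≃0⇒≡0
    (combine₂ 1ℝ (fromℚ (- 1ℚ) ⊗ (x ⊗ x ⊕ fromℚ (r - N))) (vanishes gx) eq λ i → id N r (seq x i)))
    where
    id : ∀ N r x → r * r - N * r + 1ℚ - 0ℚ ≡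
      1ℚ * (1ℚ + - N * (x * x) + 1ℚ * (x * x * (x * x)) - 0ℚ)
        + - 1ℚ * (x * x + (r - N)) * (x * x - r)
    id = solve-∀ ℚ-ring

  sum-of-squares : ∀ {x y} → Root x → Root y → x ≄ y → x ⊗ x ⊕ y ⊗ y ≃ fromℚ N
  sum-of-squares {x} {y} gx gy x≄y =
    combine₁ 1ℝ (x*y≃0⇒y≃0 (minus (x ⊗ x) (y ⊗ y)) (x ⊗ x ⊕ y ⊗ y ⊕ fromℚ (- N))
      (combine₂ 1ℝ (fromℚ (- 1ℚ)) (vanishes gx) (vanishes gy) λ i → id N (seq x i) (seq y i))
      (≄⇒difference≄0 (square-injective (positive gx) (positive gy) x≄y)))
      λ i → id′ N (seq x i) (seq y i)
    where
    id : ∀ N x y → (x * x + - 1ℚ * (y * y)) * (x * x + y * y + - N) - 0ℚ ≡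
      1ℚ * (1ℚ + - N * (x * x) + 1ℚ * (x * x * (x * x)) - 0ℚ)
        + - 1ℚ * (1ℚ + - N * (y * y) + 1ℚ * (y * y * (y * y)) - 0ℚ)
    id = solve-∀ ℚ-ring
    id′ : ∀ N x y → x * x + y * y - N ≡ 1ℚ * (x * x + y * y + - N - 0ℚ)
    id′ = solve-∀ ℚ-ring

  one-root : ∀ {x y} → x ≃ 1ℝ → Root y →
    ∀ {c₁ c₂} → fromℚ c₁ ⊗ x ⊕ fromℚ c₂ ⊗ y ≃ 0ℝ → c₁ ≡ 0ℚ × c₂ ≡ 0ℚ
  one-root {x} {y} x≃1 gy {c₁} {c₂} eq = affine-independent {t = y} y-irrational
    (combine₂ 1ℝ (fromℚ (- c₁)) eq x≃1 λ i → id c₁ c₂ (seq x i) (seq y i))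
    where
    id : ∀ c₁ c₂ x y → c₁ + c₂ * y - 0ℚ ≡ 1ℚ * (c₁ * x + c₂ * y - 0ℚ) + - c₁ * (x - 1ℚ)
    id = solve-∀ ℚ-ring
    id′ : ∀ r y → y * y - r * r ≡ (y + r) * (y - r)
    id′ = solve-∀ ℚ-ring
    y-irrational : Irrational y
    y-irrational r y≃r = root-irrational gy (r * r) (combine₁ (y ⊕ fromℚ r) y≃r λ i → id′ r (seq y i))

  -- Multiplying by c₁ x - c₂ y gives c₁² x² - c₂² y² = 0. With y² = N - x² this is an affine
  -- relation for the irrational x², whose slope is c₁² + c₂².
  root-root : ∀ {x y} → Root x → Root y → x ≄ y →
    ∀ {c₁ c₂} → fromℚ c₁ ⊗ x ⊕ fromℚ c₂ ⊗ y ≃ 0ℝ → c₁ ≡ 0ℚ × c₂ ≡ 0ℚ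
  root-root {x} {y} gx gy x≄y {c₁} {c₂} eq =
    p²+q²≡0⇒p≡0 {c₁} {c₂} squares , p²+q²≡0⇒p≡0 {c₂} {c₁} (trans (ℚ.+-comm (c₂ * c₂) (c₁ * c₁)) squares)
    where
    id : ∀ N c₁ c₂ x y → - (c₂ * c₂ * N) + (c₁ * c₁ + c₂ * c₂) * (x * x) - 0ℚ ≡
      (c₁ * x + - c₂ * y) * (c₁ * x + c₂ * y - 0ℚ) + c₂ * c₂ * (x * x + y * y - N)
    id = solve-∀ ℚ-ring
    squares : c₁ * c₁ + c₂ * c₂ ≡ 0ℚ
    squares = proj₂ (affine-independent { - (c₂ * c₂ * N)} {t = x ⊗ x} (root-irrational gx)
      (combine₂ (fromℚ c₁ ⊗ x ⊕ fromℚ (- c₂) ⊗ y) (fromℚ (c₂ * c₂)) eq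
        (sum-of-squares gx gy x≄y) λ i → id N c₁ c₂ (seq x i) (seq y i)))

  at-most-two : ∀ {x y z} → Root x → Root y → Root z → x ≄ y → x ≄ z → y ≄ z → ⊥
  at-most-two {x} {y} {z} gx gy gz x≄y x≄z y≄z = square-injective (positive gy) (positive gz) y≄z
    (combine₂ 1ℝ (fromℚ (- 1ℚ)) (sum-of-squares gx gy x≄y) (sum-of-squares gx gz x≄z)
      λ i → id N (seq x i) (seq y i) (seq z i))
    where
    id : ∀ N x y z → y * y - z * z ≡ 1ℚ * (x * x + y * y - N) + - 1ℚ * (x * x + z * z - N)
    id = solve-∀ ℚ-ring

  private
    Cases : ℝ → Set
    Cases x = x ≃ 1ℝ ⊎ Root x

    swap : ∀ {x y c₁ c₂} → fromℚ c₁ ⊗ x ⊕ fromℚ c₂ ⊗ y ≃ 0ℝ → fromℚ c₂ ⊗ y ⊕ fromℚ c₁ ⊗ x ≃ 0ℝ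
    swap {x} {y} {c₁} {c₂} eq = combine₁ 1ℝ eq λ i → id c₁ c₂ (seq x i) (seq y i)
      where
      id : ∀ c₁ c₂ x y → c₂ * y + c₁ * x - 0ℚ ≡ 1ℚ * (c₁ * x + c₂ * y - 0ℚ)
      id = solve-∀ ℚ-ring

    cases : ∀ {x} → Candidate x → ¬ ¬ Cases x
    cases (0<x , gx) k = k (inj₂ (0<x , gx λ x≃1 → k (inj₁ x≃1)))

    root : ∀ {x y} → y ≃ 1ℝ → Candidate x → x ≄ y → Root x
    root y≃1 (0<x , gx) x≄y = 0<x , gx λ x≃1 → x≄y (≃-trans x≃1 (≃-sym y≃1))

    -- At most one of four distinct candidates is 1, and the other three would be roots of a
    -- polynomial that has only two positive ones.
    four : ∀ {w x y z} → Candidate w → Candidate x → Candidate y → Candidate z →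
      x ≄ w → y ≄ w → z ≄ w → x ≄ y → x ≄ z → y ≄ z → ⊥
    four {w} {x} {y} {z} Pw Px Py Pz x≄w y≄w z≄w x≄y x≄z y≄z = cases Pw λ where
      (inj₁ w≃1) → at-most-two
        (root w≃1 Px x≄w) (root w≃1 Py y≄w) (root w≃1 Pz z≄w) x≄y x≄z y≄z
      (inj₂ gw) → cases Px λ where
        (inj₁ x≃1) → at-most-two
          (root x≃1 Py (≄-sym x≄y)) (root x≃1 Pz (≄-sym x≄z)) gw y≄z y≄w z≄w
        (inj₂ gx) → cases Py λ where
          (inj₁ y≃1) → at-most-two
            gx (root y≃1 Pz (≄-sym y≄z)) gw x≄z x≄w z≄w
          (inj₂ gy) → at-most-two gx gy gw x≄y x≄w y≄w

  independentUpToOne : IndependentUpToOne Candidate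
  independentUpToOne = record
    { two = λ {x} {y} Px Py x≄y {c₁} {c₂} eq → zero-pair-stable λ k → cases Px λ where
        (inj₁ x≃1) → k (one-root x≃1 (root x≃1 Py (≄-sym x≄y)) eq)
        (inj₂ gx)  → cases Py λ where
          (inj₁ y≃1) → let q , p = one-root y≃1 gx (swap {x} {y} {c₁} {c₂} eq) in k (p , q)
          (inj₂ gy)  → k (root-root gx gy x≄y eq)
    -- Together with the removed element there would be four candidates. The candidates 1, x, y by
    -- themselves can be dependent: for N = 7 the two positive roots satisfy x + y = 3.
    ; three = λ Pw Px Py Pz x≄w y≄w z≄w x≄y x≄z y≄z _ → ⊥-elim (four Pw Px Py Pz x≄w y≄w z≄w x≄y x≄z y≄z)
    ; five = λ Pv Pw Px Py _ v≄w v≄x v≄y _ w≄x w≄y _ x≄y _ _ →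
        four Pv Pw Px Py (≄-sym v≄w) (≄-sym v≄x) (≄-sym v≄y) w≄x w≄y x≄y
    }

-- A candidate x ≠ 1 is, up to sign, a root of g = x³ + a x² + b x + d.
module NormCubic (a b d : ℚ) (a≢0 : a ≢ 0ℚ)
  (noRoot : NoRationalRoot ((1ℚ + 1ℚ) * b - a * a) (b * b - (1ℚ + 1ℚ) * a * d) (- (d * d))) where

  Candidate : Pred ℝ 0ℓ
  Candidate = PositiveRootOrOne
    (λ x → cubic ((1ℚ + 1ℚ) * b - a * a) (b * b - (1ℚ + 1ℚ) * a * d) (- (d * d)) (x ⊗ x))

  -- The norm takes the value - g(r) g(-r) at r², so a rational root r of g would make r² a rational
  -- root of the norm.
  noRootᵍ : NoRationalRoot a b d
  noRootᵍ r gr≡0 = noRoot (r * r) (combineℚ₁ (r * (r * r + b) - (a * (r * r) + d)) gr≡0 (id a b d r))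
    where
    id : ∀ a b d r →
      r * r * (r * r) * (r * r) + ((1ℚ + 1ℚ) * b - a * a) * (r * r * (r * r))
        + (b * b - (1ℚ + 1ℚ) * a * d) * (r * r) + - (d * d) - 0ℚ ≡
      (r * (r * r + b) - (a * (r * r) + d)) * (r * r * r + a * (r * r) + b * r + d - 0ℚ)
    id = solve-∀ ℚ-ring

  open ConjugateRoots {a} {b} {d} noRootᵍ

  -- A sign stored as a rational with square 1 lets both cases share one computation: in a linear
  -- relation it moves from the root to the coefficient.
  record Root (x : ℝ) : Set where
    field
      positive : 0ℝ < x
      sign     : ℚ
      sign²≡1  : sign * sign ≡ 1ℚ
      root     : cubic a b d (fromℚ sign ⊗ x) ≃ 0ℝ

  open Root

  signed : ∀ {x} → Root x → ℝ
  signed {x} r = fromℚ (sign r) ⊗ x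

  -- Signs disappear on squaring, and distinct positive numbers have distinct squares; in particular
  -- x and - y cannot coincide.
  signed-≄ : ∀ {x y} (r : Root x) (s : Root y) → x ≄ y → signed r ≄ signed s
  signed-≄ {x} {y} r s x≄y eq = square-injective (positive r) (positive s) x≄y
    (combine₃ (signed r ⊕ signed s) (fromℚ (- 1ℚ) ⊗ (x ⊗ x)) (y ⊗ y)
      eq (fromℚ-cong (sign²≡1 r)) (fromℚ-cong (sign²≡1 s))
      λ i → id (sign r) (sign s) (seq x i) (seq y i))
    where
    id : ∀ σ τ x y → x * x - y * y ≡
      (σ * x + τ * y) * (σ * x - τ * y) + - 1ℚ * (x * x) * (σ * σ - 1ℚ) + y * y * (τ * τ - 1ℚ)
    id = solve-∀ ℚ-ring

  unsign : ∀ {x} (r : Root x) {c} → c * sign r ≡ 0ℚ → c ≡ 0ℚ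
  unsign r {c} eq = combineℚ₂ (sign r) (- c) eq (sign²≡1 r) (id c (sign r))
    where
    id : ∀ c σ → c - 0ℚ ≡ σ * (c * σ - 0ℚ) + - c * (σ * σ - 1ℚ)
    id = solve-∀ ℚ-ring

  roots₂ : ∀ {x y} → Root x → Root y → x ≄ y →
    ∀ {c₀ c₁ c₂} → fromℚ c₀ ⊕ fromℚ c₁ ⊗ x ⊕ fromℚ c₂ ⊗ y ≃ 0ℝ → c₀ ≡ 0ℚ × c₁ ≡ 0ℚ × c₂ ≡ 0ℚ
  roots₂ {x} {y} r s x≄y {c₀} {c₁} {c₂} eq = use (independent₂ (root r) (root s) (signed-≄ r s x≄y)
      (combine₃ 1ℝ (fromℚ c₁ ⊗ x) (fromℚ c₂ ⊗ y) eq (fromℚ-cong (sign²≡1 r)) (fromℚ-cong (sign²≡1 s))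
        λ i → id c₀ c₁ c₂ (sign r) (sign s) (seq x i) (seq y i)))
    where
    id : ∀ c₀ c₁ c₂ σ τ x y → c₀ + c₁ * σ * (σ * x) + c₂ * τ * (τ * y) - 0ℚ ≡
      1ℚ * (c₀ + c₁ * x + c₂ * y - 0ℚ) + c₁ * x * (σ * σ - 1ℚ) + c₂ * y * (τ * τ - 1ℚ)
    id = solve-∀ ℚ-ring
    use : c₀ ≡ 0ℚ × c₁ * sign r ≡ 0ℚ × c₂ * sign s ≡ 0ℚ → c₀ ≡ 0ℚ × c₁ ≡ 0ℚ × c₂ ≡ 0ℚ
    use (p , q , t) = p , unsign r q , unsign s t

  roots₁ : ∀ {x} → Root x → ∀ {c₀ c₁} → fromℚ c₀ ⊕ fromℚ c₁ ⊗ x ≃ 0ℝ → c₀ ≡ 0ℚ × c₁ ≡ 0ℚ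
  roots₁ {x} r {c₀} {c₁} eq = use (affine-independent {t = signed r}
      (CubicIrrational.irrational {a} {b} {d} noRootᵍ {signed r} (root r))
      (combine₂ 1ℝ (fromℚ c₁ ⊗ x) eq (fromℚ-cong (sign²≡1 r)) λ i → id c₀ c₁ (sign r) (seq x i)))
    where
    id : ∀ c₀ c₁ σ x → c₀ + c₁ * σ * (σ * x) - 0ℚ ≡ 1ℚ * (c₀ + c₁ * x - 0ℚ) + c₁ * x * (σ * σ - 1ℚ)
    id = solve-∀ ℚ-ring
    use : c₀ ≡ 0ℚ × c₁ * sign r ≡ 0ℚ → c₀ ≡ 0ℚ × c₁ ≡ 0ℚ
    use (p , q) = p , unsign r q

  roots₃ : ∀ {x y z} → Root x → Root y → Root z → x ≄ y → x ≄ z → y ≄ z →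
    ∀ {c₁ c₂ c₃} → fromℚ c₁ ⊗ x ⊕ fromℚ c₂ ⊗ y ⊕ fromℚ c₃ ⊗ z ≃ 0ℝ → c₁ ≡ 0ℚ × c₂ ≡ 0ℚ × c₃ ≡ 0ℚ
  roots₃ {x} {y} {z} r s t x≄y x≄z y≄z {c₁} {c₂} {c₃} eq =
    use (independent₃ a≢0 (root r) (root s) (root t) (signed-≄ r s x≄y) (signed-≄ r t x≄z) (signed-≄ s t y≄z)
      (combine₂ 1ℝ (fromℚ c₃ ⊗ z) signed₂ (fromℚ-cong (sign²≡1 t))
        λ i → id₂ (c₁ * sign r * (sign r * seq x i) + c₂ * sign s * (sign s * seq y i)) c₃ (sign t) (seq z i)))
    where
    id : ∀ c₁ c₂ c₃ σ τ x y z → c₁ * σ * (σ * x) + c₂ * τ * (τ * y) + c₃ * z - 0ℚ ≡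
      1ℚ * (c₁ * x + c₂ * y + c₃ * z - 0ℚ) + c₁ * x * (σ * σ - 1ℚ) + c₂ * y * (τ * τ - 1ℚ)
    id = solve-∀ ℚ-ring
    signed₂ : fromℚ (c₁ * sign r) ⊗ signed r ⊕ fromℚ (c₂ * sign s) ⊗ signed s ⊕ fromℚ c₃ ⊗ z ≃ 0ℝ
    signed₂ = combine₃ 1ℝ (fromℚ c₁ ⊗ x) (fromℚ c₂ ⊗ y)
      eq (fromℚ-cong (sign²≡1 r)) (fromℚ-cong (sign²≡1 s))
      λ i → id c₁ c₂ c₃ (sign r) (sign s) (seq x i) (seq y i) (seq z i)
    id₂ : ∀ p c σ z → p + c * σ * (σ * z) - 0ℚ ≡ 1ℚ * (p + c * z - 0ℚ) + c * z * (σ * σ - 1ℚ)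
    id₂ = solve-∀ ℚ-ring
    use : c₁ * sign r ≡ 0ℚ × c₂ * sign s ≡ 0ℚ × c₃ * sign t ≡ 0ℚ → c₁ ≡ 0ℚ × c₂ ≡ 0ℚ × c₃ ≡ 0ℚ
    use (p , q , u) = unsign r p , unsign s q , unsign t u

  roots₄ : ∀ {w x y z} → Root w → Root x → Root y → Root z →
    w ≄ x → w ≄ y → w ≄ z → x ≄ y → x ≄ z → y ≄ z → ⊥
  roots₄ q r s t w≄x w≄y w≄z x≄y x≄z y≄z = at-most-three (root q) (root r) (root s) (root t)
    (signed-≄ q r w≄x) (signed-≄ q s w≄y) (signed-≄ r s x≄y)
    (signed-≄ q t w≄z) (signed-≄ r t x≄z) (signed-≄ s t y≄z)

  private
    -- The product g(x) g(-x) is 0, but which factor vanishes is undecidable; hence the double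
    -- negation.
    rootʳ : ∀ {x} → Candidate x → x ≄ 1ℝ → ¬ ¬ Root x
    rootʳ {x} (0<x , eq) x≄1 k = plus λ gx → k record
        { positive = 0<x ; sign = 1ℚ ; sign²≡1 = refl
        ; root = combine₁ 1ℝ gx λ i → id₁ a b d (seq x i) }
      where
      id₁ : ∀ a b d x →
        1ℚ * x * (1ℚ * x) * (1ℚ * x) + a * (1ℚ * x * (1ℚ * x)) + b * (1ℚ * x) + d - 0ℚ ≡
        1ℚ * (x * x * x + a * (x * x) + b * x + d - 0ℚ)
      id₁ = solve-∀ ℚ-ring
      id₂ : ∀ a b d x →
        (x * x * x + a * (x * x) + b * x + d) *
          (- 1ℚ * x * (- 1ℚ * x) * (- 1ℚ * x) + a * (- 1ℚ * x * (- 1ℚ * x)) + b * (- 1ℚ * x) + d) - 0ℚ ≡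
        - 1ℚ * (x * x * (x * x) * (x * x) + ((1ℚ + 1ℚ) * b - a * a) * (x * x * (x * x))
          + (b * b - (1ℚ + 1ℚ) * a * d) * (x * x) + - (d * d) - 0ℚ)
      id₂ = solve-∀ ℚ-ring
      plus : ¬ (cubic a b d x ≄ 0ℝ)
      plus gx≄0 = k record
        { positive = 0<x ; sign = - 1ℚ ; sign²≡1 = refl
        ; root = x*y≃0⇒y≃0 (cubic a b d x) (cubic a b d (fromℚ (- 1ℚ) ⊗ x))
            (combine₁ (fromℚ (- 1ℚ)) (eq x≄1) λ i → id₂ a b d (seq x i)) gx≄0 }

    Cases : ℝ → Set
    Cases x = x ≃ 1ℝ ⊎ Root x

    cases : ∀ {x} → Candidate x → ¬ ¬ Cases x
    cases Px k = rootʳ Px (λ x≃1 → k (inj₁ x≃1)) λ r → k (inj₂ r)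

    other : ∀ {x y} → x ≃ 1ℝ → Candidate y → x ≄ y → ¬ ¬ Root y
    other x≃1 Py x≄y = rootʳ Py λ y≃1 → x≄y (≃-trans x≃1 (≃-sym y≃1))

    two : ∀ {x y} → Candidate x → Candidate y → x ≄ y →
      ∀ {c₁ c₂} → fromℚ c₁ ⊗ x ⊕ fromℚ c₂ ⊗ y ≃ 0ℝ → ¬ ¬ (c₁ ≡ 0ℚ × c₂ ≡ 0ℚ)
    two {x} {y} Px Py x≄y {c₁} {c₂} eq k = cases Px λ where
        (inj₁ x≃1) → other x≃1 Py x≄y λ s →
          k (roots₁ s (combine₂ 1ℝ (fromℚ (- c₁)) eq x≃1 λ i → id₁ c₁ c₂ (seq x i) (seq y i)))
        (inj₂ r) → cases Py λ where
          (inj₁ y≃1) → let q , p = roots₁ r (combine₂ 1ℝ (fromℚ (- c₂)) eq y≃1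
                                     λ i → id₂ c₁ c₂ (seq x i) (seq y i)) in k (p , q)
          (inj₂ s) → k (proj₂ (roots₂ r s x≄y {0ℚ} (combine₁ 1ℝ eq λ i → id₃ c₁ c₂ (seq x i) (seq y i))))
      where
      id₁ : ∀ c₁ c₂ x y → c₁ + c₂ * y - 0ℚ ≡ 1ℚ * (c₁ * x + c₂ * y - 0ℚ) + - c₁ * (x - 1ℚ)
      id₁ = solve-∀ ℚ-ring
      id₂ : ∀ c₁ c₂ x y → c₂ + c₁ * x - 0ℚ ≡ 1ℚ * (c₁ * x + c₂ * y - 0ℚ) + - c₂ * (y - 1ℚ)
      id₂ = solve-∀ ℚ-ring
      id₃ : ∀ c₁ c₂ x y → 0ℚ + c₁ * x + c₂ * y - 0ℚ ≡ 1ℚ * (c₁ * x + c₂ * y - 0ℚ)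
      id₃ = solve-∀ ℚ-ring

    three : ∀ {x y z} → Candidate x → Candidate y → Candidate z → x ≄ y → x ≄ z → y ≄ z →
      ∀ {c₁ c₂ c₃} → fromℚ c₁ ⊗ x ⊕ fromℚ c₂ ⊗ y ⊕ fromℚ c₃ ⊗ z ≃ 0ℝ →
      ¬ ¬ (c₁ ≡ 0ℚ × c₂ ≡ 0ℚ × c₃ ≡ 0ℚ)
    three {x} {y} {z} Px Py Pz x≄y x≄z y≄z {c₁} {c₂} {c₃} eq k = cases Px λ where
        (inj₁ x≃1) → other x≃1 Py x≄y λ s → other x≃1 Pz x≄z λ t →
          k (roots₂ s t y≄z (combine₂ 1ℝ (fromℚ (- c₁)) eq x≃1
            λ i → id₁ c₁ c₂ c₃ (seq x i) (seq y i) (seq z i)))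
        (inj₂ r) → cases Py λ where
          (inj₁ y≃1) → other y≃1 Pz y≄z λ t →
            let p₂ , p₁ , p₃ = roots₂ r t x≄z (combine₂ 1ℝ (fromℚ (- c₂)) eq y≃1
                                 λ i → id₂ c₁ c₂ c₃ (seq x i) (seq y i) (seq z i)) in k (p₁ , p₂ , p₃)
          (inj₂ s) → cases Pz λ where
            (inj₁ z≃1) →
              let p₃ , p₁ , p₂ = roots₂ r s x≄y (combine₂ 1ℝ (fromℚ (- c₃)) eq z≃1
                                   λ i → id₃ c₁ c₂ c₃ (seq x i) (seq y i) (seq z i)) in k (p₁ , p₂ , p₃)
            (inj₂ t) → k (roots₃ r s t x≄y x≄z y≄z eq)
      where
      id₁ : ∀ c₁ c₂ c₃ x y z → c₁ + c₂ * y + c₃ * z - 0ℚ ≡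
        1ℚ * (c₁ * x + c₂ * y + c₃ * z - 0ℚ) + - c₁ * (x - 1ℚ)
      id₁ = solve-∀ ℚ-ring
      id₂ : ∀ c₁ c₂ c₃ x y z → c₂ + c₁ * x + c₃ * z - 0ℚ ≡
        1ℚ * (c₁ * x + c₂ * y + c₃ * z - 0ℚ) + - c₂ * (y - 1ℚ)
      id₂ = solve-∀ ℚ-ring
      id₃ : ∀ c₁ c₂ c₃ x y z → c₃ + c₁ * x + c₂ * y - 0ℚ ≡
        1ℚ * (c₁ * x + c₂ * y + c₃ * z - 0ℚ) + - c₃ * (z - 1ℚ)
      id₃ = solve-∀ ℚ-ring

    five : ∀ {v w x y z} → Candidate v → Candidate w → Candidate x → Candidate y → Candidate z →
      v ≄ w → v ≄ x → v ≄ y → v ≄ z → w ≄ x → w ≄ y → w ≄ z → x ≄ y → x ≄ z → y ≄ z → ⊥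
    five Pv Pw Px Py Pz v≄w v≄x v≄y v≄z w≄x w≄y w≄z x≄y x≄z y≄z = cases Pv λ where
      (inj₁ v≃1) → other v≃1 Pw v≄w λ w → other v≃1 Px v≄x λ x →
        other v≃1 Py v≄y λ y → other v≃1 Pz v≄z λ z → roots₄ w x y z w≄x w≄y w≄z x≄y x≄z y≄z
      (inj₂ v) → cases Pw λ where
        (inj₁ w≃1) → other w≃1 Px w≄x λ x → other w≃1 Py w≄y λ y → other w≃1 Pz w≄z λ z →
          roots₄ v x y z v≄x v≄y v≄z x≄y x≄z y≄z
        (inj₂ w) → cases Px λ where
          (inj₁ x≃1) → other x≃1 Py x≄y λ y → other x≃1 Pz x≄z λ z →
            roots₄ v w y z v≄w v≄y v≄z w≄y w≄z y≄z
          (inj₂ x) → cases Py λ where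
            (inj₁ y≃1) → other y≃1 Pz y≄z λ z → roots₄ v w x z v≄w v≄x v≄z w≄x w≄z x≄z
            (inj₂ y) → roots₄ v w x y v≄w v≄x v≄y w≄x w≄y x≄y

  independentUpToOne : IndependentUpToOne Candidate
  independentUpToOne = record
    { two   = λ Px Py x≄y eq → zero-pair-stable (two Px Py x≄y eq)
    ; three = λ _ Px Py Pz _ _ _ x≄y x≄z y≄z eq → zero-triple-stable (three Px Py Pz x≄y x≄z y≄z eq)
    ; five  = five
    }

-- Rational roots

fromℤ-+ : ∀ i j → fromℤ (i ℤ.+ j) ≡ fromℤ i + fromℤ j
fromℤ-+ i j = sym (trans (cong (ℚ._/ 1) (cong₂ ℤ._+_ (ℤ.*-identityʳ i) (ℤ.*-identityʳ j))) (ℚ.↥p/↧p≡p (fromℤ (i ℤ.+ j))))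

fromℤ-* : ∀ i j → fromℤ (i ℤ.* j) ≡ fromℤ i * fromℤ j
fromℤ-* i j = sym (ℚ.↥p/↧p≡p (fromℤ (i ℤ.* j)))

fromℕ≡fromℤ : ∀ n → fromℕ n ≡ fromℤ (+ n)
fromℕ≡fromℤ n = ℚ.↥p/↧p≡p (fromℤ (+ n))

fromℕ-+ : ∀ m n → fromℕ (m ℕ.+ n) ≡ fromℕ m + fromℕ n
fromℕ-+ m n = trans (fromℕ≡fromℤ (m ℕ.+ n)) (trans (fromℤ-+ (+ m) (+ n))
  (sym (cong₂ _+_ (fromℕ≡fromℤ m) (fromℕ≡fromℤ n))))

fromℕ-* : ∀ m n → fromℕ (m ℕ.* n) ≡ fromℕ m * fromℕ n
fromℕ-* m n = trans (fromℕ≡fromℤ (m ℕ.* n)) (trans (cong fromℤ (ℤ.pos-* m n)) (trans (fromℤ-* (+ m) (+ n))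
  (sym (cong₂ _*_ (fromℕ≡fromℤ m) (fromℕ≡fromℤ n)))))

fromℕ-suc : ∀ n → fromℕ (suc n) ≡ 1ℚ + fromℕ n
fromℕ-suc = fromℕ-+ 1

fromℕ≡0⇒≡0 : ∀ n → fromℕ n ≡ 0ℚ → n ≡ 0
fromℕ≡0⇒≡0 n eq = ℤ.+-injective (cong ℚ.numerator (trans (sym (fromℕ≡fromℤ n)) eq))

fromℕ-nonNegative : ∀ n → 0ℚ ℚ.≤ fromℕ n
fromℕ-nonNegative n = subst (0ℚ ℚ.≤_) (sym (fromℕ≡fromℤ n)) (ℚ.nonNegative⁻¹ (fromℤ (+ n)))

numerator-eq : ∀ y → y * fromℤ (ℚ.denominator y) ≡ fromℤ (ℚ.numerator y)
numerator-eq y@record{} = ℚ.toℚᵘ-injective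
  (ℚᵘ.≃-trans (ℚ.toℚᵘ-homo-* y (fromℤ (ℚ.denominator y))) (ℚᵘ.*≡* (id (ℚ.numerator y) (ℚ.denominator y))))
  where
  id : ∀ p q → p ℤ.* q ℤ.* + 1 ≡ p ℤ.* (q ℤ.* + 1)
  id = ℤ-Solver.solve-∀

private
  fromℤ-cube+monomial : ∀ w i j k l → fromℤ (w ℤ.* w ℤ.* w ℤ.+ i ℤ.* j ℤ.* k ℤ.* l) ≡
    fromℤ w * fromℤ w * fromℤ w + fromℤ i * fromℤ j * fromℤ k * fromℤ l
  fromℤ-cube+monomial w i j k l = trans (fromℤ-+ (w ℤ.* w ℤ.* w) (i ℤ.* j ℤ.* k ℤ.* l))
    (cong₂ _+_ (homo₃ w w w) (trans (fromℤ-* (i ℤ.* j ℤ.* k) l) (cong (_* fromℤ l) (homo₃ i j k))))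
    where
    homo₃ : ∀ i j k → fromℤ (i ℤ.* j ℤ.* k) ≡ fromℤ i * fromℤ j * fromℤ k
    homo₃ i j k = trans (fromℤ-* (i ℤ.* j) k) (cong (_* fromℤ k) (fromℤ-* i j))

  -- For y = u / v, the equation cleared of denominators.
  module Cleared (s t : ℕ) (y : ℚ) (eq : cubicℚ (- fromℕ s) (fromℕ t) (- 1ℚ) y ≡ 0ℚ) where
    u v : ℤ
    u = ℚ.numerator y
    v = ℚ.denominator y

    id : ∀ s t y u v →
      u * u * u + t * u * v * v - (v * v * v + s * u * u * v) ≡
      v * v * v * (y * y * y + - s * (y * y) + t * y + - 1ℚ - 0ℚ)
        + - (u * u + u * (y * v) + y * v * (y * v) + t * v * v - s * v * (u + y * v)) * (y * v - u)
    id = solve-∀ ℚ-ring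

    cleared : u ℤ.* u ℤ.* u ℤ.+ + t ℤ.* u ℤ.* v ℤ.* v ≡ v ℤ.* v ℤ.* v ℤ.+ + s ℤ.* u ℤ.* u ℤ.* v
    cleared = cong ℚ.numerator (trans (fromℤ-cube+monomial u (+ t) u v v) (trans
      (combineℚ₂ (Q * Q * Q) (- (P * P + P * (y * Q) + y * Q * (y * Q) + T * Q * Q - S * Q * (P + y * Q)))
        (subst₂ (λ s t → cubicℚ (- s) t (- 1ℚ) y ≡ 0ℚ) (fromℕ≡fromℤ s) (fromℕ≡fromℤ t) eq)
        (numerator-eq y) (id S T y P Q))
      (sym (fromℤ-cube+monomial v (+ s) u u v))))
      where
      P Q S T : ℚ
      P = fromℤ u
      Q = fromℤ v
      S = fromℤ (+ s)
      T = fromℤ (+ t)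

    u∣v³ : u ℤ.* (u ℤ.* u ℤ.+ + t ℤ.* v ℤ.* v ℤ.- + s ℤ.* u ℤ.* v) ≡ v ℤ.* (v ℤ.* (v ℤ.* + 1))
    u∣v³ = trans (e₁ u v (+ s) (+ t)) (trans (cong (ℤ._- + s ℤ.* u ℤ.* u ℤ.* v) cleared) (e₂ u v (+ s)))
      where
      e₁ : ∀ u v s t → u ℤ.* (u ℤ.* u ℤ.+ t ℤ.* v ℤ.* v ℤ.- s ℤ.* u ℤ.* v) ≡
        u ℤ.* u ℤ.* u ℤ.+ t ℤ.* u ℤ.* v ℤ.* v ℤ.- s ℤ.* u ℤ.* u ℤ.* v
      e₁ = ℤ-Solver.solve-∀
      e₂ : ∀ u v s → v ℤ.* v ℤ.* v ℤ.+ s ℤ.* u ℤ.* u ℤ.* v ℤ.- s ℤ.* u ℤ.* u ℤ.* v ≡ v ℤ.* (v ℤ.* (v ℤ.* + 1))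
      e₂ = ℤ-Solver.solve-∀

    v∣u³ : v ℤ.* (v ℤ.* v ℤ.+ + s ℤ.* u ℤ.* u ℤ.- + t ℤ.* u ℤ.* v) ≡ u ℤ.* (u ℤ.* (u ℤ.* + 1))
    v∣u³ = trans (e₁ u v (+ s) (+ t)) (trans (cong (ℤ._- + t ℤ.* u ℤ.* v ℤ.* v) (sym cleared)) (e₂ u v (+ t)))
      where
      e₁ : ∀ u v s t → v ℤ.* (v ℤ.* v ℤ.+ s ℤ.* u ℤ.* u ℤ.- t ℤ.* u ℤ.* v) ≡
        v ℤ.* v ℤ.* v ℤ.+ s ℤ.* u ℤ.* u ℤ.* v ℤ.- t ℤ.* u ℤ.* v ℤ.* v
      e₁ = ℤ-Solver.solve-∀
      e₂ : ∀ u v t → u ℤ.* u ℤ.* u ℤ.+ t ℤ.* u ℤ.* v ℤ.* v ℤ.- t ℤ.* u ℤ.* v ℤ.* v ≡ u ℤ.* (u ℤ.* (u ℤ.* + 1))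
      e₂ = ℤ-Solver.solve-∀

  -- The factor 1 at the end of the cube is what remains once coprimality has cancelled the three
  -- factors j, so that i divides 1.
  coprime-∣cube : ∀ i j k → Coprime ℤ.∣ i ∣ ℤ.∣ j ∣ → i ℤ.* k ≡ j ℤ.* (j ℤ.* (j ℤ.* + 1)) → ℤ.∣ i ∣ ≡ 1
  coprime-∣cube i j k cop eq = ∣1⇒≡1 (coprime-divisor cop (coprime-divisor cop (coprime-divisor cop
    (divides ℤ.∣ k ∣ (begin
      ℤ.∣ j ∣ ℕ.* (ℤ.∣ j ∣ ℕ.* (ℤ.∣ j ∣ ℕ.* 1))  ≡⟨ cong (λ n → ℤ.∣ j ∣ ℕ.* (ℤ.∣ j ∣ ℕ.* n)) (ℤ.abs-* j (+ 1)) ⟨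
      ℤ.∣ j ∣ ℕ.* (ℤ.∣ j ∣ ℕ.* ℤ.∣ j ℤ.* + 1 ∣)  ≡⟨ cong (ℤ.∣ j ∣ ℕ.*_) (ℤ.abs-* j (j ℤ.* + 1)) ⟨
      ℤ.∣ j ∣ ℕ.* ℤ.∣ j ℤ.* (j ℤ.* + 1) ∣        ≡⟨ ℤ.abs-* j (j ℤ.* (j ℤ.* + 1)) ⟨
      ℤ.∣ j ℤ.* (j ℤ.* (j ℤ.* + 1)) ∣            ≡⟨ cong ℤ.∣_∣ eq ⟨
      ℤ.∣ i ℤ.* k ∣                              ≡⟨ ℤ.abs-* i k ⟩
      ℤ.∣ i ∣ ℕ.* ℤ.∣ k ∣                        ≡⟨ ℕ.*-comm ℤ.∣ i ∣ ℤ.∣ k ∣ ⟩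
      ℤ.∣ k ∣ ℕ.* ℤ.∣ i ∣                        ∎)))))
    where open ≡-Reasoning

  unit : ∀ y → ℤ.∣ ℚ.numerator y ∣ ≡ 1 → ℤ.∣ ℚ.denominator y ∣ ≡ 1 → y ≡ 1ℚ ⊎ y ≡ - 1ℚ
  unit (mkℚ (+ _) zero _)    refl refl = inj₁ refl
  unit (mkℚ -[1+ _ ] zero _) refl refl = inj₂ refl

  lowest-terms : ∀ y → Coprime ℤ.∣ ℚ.numerator y ∣ ℤ.∣ ℚ.denominator y ∣
  lowest-terms (mkℚ n d c) = Coprimality.recompute c

-- The rational root theorem: leading and constant coefficients are units, so in lowest terms the
-- numerator divides the cube of the denominator and conversely, and both are units.
rational-root : ∀ s t y → cubicℚ (- fromℕ s) (fromℕ t) (- 1ℚ) y ≡ 0ℚ → y ≡ 1ℚ ⊎ y ≡ - 1ℚ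
rational-root s t y eq = unit y
    (coprime-∣cube u v _ coprime u∣v³)
    (coprime-∣cube v u _ (Coprimality.sym coprime) v∣u³)
  where
  open Cleared s t y eq
  coprime : Coprime ℤ.∣ u ∣ ℤ.∣ v ∣
  coprime = lowest-terms y

-- Polynomials over ℚ

coeff-+ₚ : ∀ f g k → coeff (f +ₚ g) k ≡ coeff f k + coeff g k
coeff-+ₚ []      g       k       = sym (ℚ.+-identityˡ (coeff g k))
coeff-+ₚ (a ∷ f) []      k       = sym (ℚ.+-identityʳ (coeff (a ∷ f) k))
coeff-+ₚ (a ∷ f) (b ∷ g) zero    = refl
coeff-+ₚ (a ∷ f) (b ∷ g) (suc k) = coeff-+ₚ f g k

coeff-scale : ∀ a g k → coeff (map (a *_) g) k ≡ a * coeff g k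
coeff-scale a []      k       = sym (ℚ.*-zeroʳ a)
coeff-scale a (b ∷ g) zero    = refl
coeff-scale a (b ∷ g) (suc k) = coeff-scale a g k

coeff-∷-*ₚ : ∀ a f g k → coeff ((a ∷ f) *ₚ g) k ≡ a * coeff g k + coeff (0ℚ ∷ f *ₚ g) k
coeff-∷-*ₚ a f g k = trans (coeff-+ₚ (map (a *_) g) (0ℚ ∷ f *ₚ g) k)
  (cong (_+ coeff (0ℚ ∷ f *ₚ g) k) (coeff-scale a g k))

IsZero : Poly → Set
IsZero f = ∀ k → coeff f k ≡ 0ℚ

Degree : Poly → ℕ → Set
Degree f k = coeff f k ≢ 0ℚ × (∀ j → k ℕ.< j → coeff f j ≡ 0ℚ)

zero-or-degree : ∀ f → IsZero f ⊎ ∃[ k ] Degree f k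
zero-or-degree [] = inj₁ λ _ → refl
zero-or-degree (a ∷ f) with zero-or-degree f | a ℚ.≟ 0ℚ
... | inj₂ (k , lead , above) | _       = inj₂ (suc k , lead , λ { (suc j) (s<s k<j) → above j k<j })
... | inj₁ f≡0                | yes a≡0 = inj₁ λ { zero → a≡0 ; (suc k) → f≡0 k }
... | inj₁ f≡0                | no a≢0  = inj₂ (0 , a≢0 , λ { (suc j) _ → f≡0 j })

nonConstant-degree : ∀ f → NonConstant f → ∃[ k ] Degree f (suc k)
nonConstant-degree f (i , ci≢0) with zero-or-degree f
... | inj₁ f≡0                        = contradiction (f≡0 (suc i)) ci≢0
... | inj₂ (suc k , deg)              = k , deg
... | inj₂ (zero , _ , above)         = contradiction (above (suc i) z<s) ci≢0

*ₚ-zeroˡ : ∀ f g → IsZero f → IsZero (f *ₚ g)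
*ₚ-zeroˡ []      g f≡0 k = refl
*ₚ-zeroˡ (a ∷ f) g f≡0 k = trans (coeff-∷-*ₚ a f g k)
  (cong₂ _+_ (trans (cong (_* coeff g k) (f≡0 0)) (ℚ.*-zeroˡ (coeff g k))) (rest k))
  where
  rest : ∀ k → coeff (0ℚ ∷ f *ₚ g) k ≡ 0ℚ
  rest zero    = refl
  rest (suc k) = *ₚ-zeroˡ f g (λ j → f≡0 (suc j)) k

leading-*ₚ : ∀ f g j k → Degree f j → Degree g k → coeff (f *ₚ g) (j ℕ.+ k) ≡ coeff f j * coeff g k
leading-*ₚ []      g j k (lead , _) _ = contradiction refl lead
leading-*ₚ (a ∷ f) g zero k (_ , above) _ = trans (coeff-∷-*ₚ a f g k)
  (trans (cong (λ p → a * coeff g k + p) (rest k)) (ℚ.+-identityʳ (a * coeff g k)))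
  where
  rest : ∀ k → coeff (0ℚ ∷ f *ₚ g) k ≡ 0ℚ
  rest zero    = refl
  rest (suc k) = *ₚ-zeroˡ f g (λ i → above (suc i) z<s) k
leading-*ₚ (a ∷ f) g (suc j) k (lead , above) dg@(_ , aboveᵍ) = trans (coeff-∷-*ₚ a f g (suc j ℕ.+ k))
  (trans (cong₂ _+_ (trans (cong (a *_) (aboveᵍ (suc j ℕ.+ k) (s≤s (ℕ.m≤n+m k j)))) (ℚ.*-zeroʳ a))
                    (leading-*ₚ f g j k (lead , λ i j<i → above (suc i) (s<s j<i)) dg))
         (ℚ.+-identityˡ (coeff f j * coeff g k)))

-- Evaluation at a real number, and factors of low degree

eval : Poly → ℝ → ℝ
eval []      t = 0ℝ
eval (a ∷ f) t = fromℚ a ⊕ t ⊗ eval f t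

eval-zero : ∀ f t → IsZero f → eval f t ≃ 0ℝ
eval-zero []      t f≡0 = by-identity λ _ → refl
eval-zero (a ∷ f) t f≡0 = combine₂ 1ℝ t (fromℚ-cong (f≡0 0)) (eval-zero f t λ k → f≡0 (suc k))
  λ i → id a (seq t i) (seq (eval f t) i)
  where
  id : ∀ a t e → a + t * e - 0ℚ ≡ 1ℚ * (a - 0ℚ) + t * (e - 0ℚ)
  id = solve-∀ ℚ-ring

eval-cong : ∀ f g t → f ≈ₚ g → eval f t ≃ eval g t
eval-cong []      g       t f≈g = ≃-sym (eval-zero g t λ k → sym (f≈g k))
eval-cong (a ∷ f) []      t f≈g = eval-zero (a ∷ f) t f≈g
eval-cong (a ∷ f) (b ∷ g) t f≈g = combine₂ 1ℝ t (fromℚ-cong (f≈g 0)) (eval-cong f g t λ k → f≈g (suc k))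
  λ i → id a b (seq t i) (seq (eval f t) i) (seq (eval g t) i)
  where
  id : ∀ a b t e f → a + t * e - (b + t * f) ≡ 1ℚ * (a - b) + t * (e - f)
  id = solve-∀ ℚ-ring

eval-+ₚ : ∀ f g t → eval (f +ₚ g) t ≃ eval f t ⊕ eval g t
eval-+ₚ []      g       t = by-identity λ i → id (seq (eval g t) i)
  where
  id : ∀ e → e - (0ℚ + e) ≡ 0ℚ
  id = solve-∀ ℚ-ring
eval-+ₚ (a ∷ f) []      t = by-identity λ i → id (seq (eval (a ∷ f) t) i)
  where
  id : ∀ e → e - (e + 0ℚ) ≡ 0ℚ
  id = solve-∀ ℚ-ring
eval-+ₚ (a ∷ f) (b ∷ g) t = combine₁ t (eval-+ₚ f g t)
  λ i → id a b (seq t i) (seq (eval (f +ₚ g) t) i) (seq (eval f t) i) (seq (eval g t) i)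
  where
  id : ∀ a b t s e f → a + b + t * s - (a + t * e + (b + t * f)) ≡ t * (s - (e + f))
  id = solve-∀ ℚ-ring

eval-scale : ∀ a g t → eval (map (a *_) g) t ≃ fromℚ a ⊗ eval g t
eval-scale a []      t = by-identity λ i → id a
  where
  id : ∀ a → 0ℚ - a * 0ℚ ≡ 0ℚ
  id = solve-∀ ℚ-ring
eval-scale a (b ∷ g) t = combine₁ t (eval-scale a g t)
  λ i → id a b (seq t i) (seq (eval (map (a *_) g) t) i) (seq (eval g t) i)
  where
  id : ∀ a b t s e → a * b + t * s - a * (b + t * e) ≡ t * (s - a * e)
  id = solve-∀ ℚ-ring

eval-*ₚ : ∀ f g t → eval (f *ₚ g) t ≃ eval f t ⊗ eval g t
eval-*ₚ []      g t = by-identity λ i → id (seq (eval g t) i)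
  where
  id : ∀ e → 0ℚ - 0ℚ * e ≡ 0ℚ
  id = solve-∀ ℚ-ring
eval-*ₚ (a ∷ f) g t = combine₃ 1ℝ 1ℝ t
  (eval-+ₚ (map (a *_) g) (0ℚ ∷ f *ₚ g) t) (eval-scale a g t) (eval-*ₚ f g t)
  λ i → id a (seq t i) (seq (eval (map (a *_) g +ₚ (0ℚ ∷ f *ₚ g)) t) i)
           (seq (eval (map (a *_) g) t) i) (seq (eval (f *ₚ g) t) i) (seq (eval f t) i) (seq (eval g t) i)
  where
  id : ∀ a t s u p f g → s - (a + t * f) * g ≡
    1ℚ * (s - (u + (0ℚ + t * p))) + 1ℚ * (u - a * g) + t * (p - f * g)
  id = solve-∀ ℚ-ring

truncate₆ : Poly → Poly
truncate₆ f = coeff f 0 ∷ coeff f 1 ∷ coeff f 2 ∷ coeff f 3 ∷ coeff f 4 ∷ coeff f 5 ∷ []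

truncate₆-≈ₚ : ∀ f k → Degree f k → k ℕ.≤ 5 → f ≈ₚ truncate₆ f
truncate₆-≈ₚ f k (_ , above) k≤5 0 = refl
truncate₆-≈ₚ f k (_ , above) k≤5 1 = refl
truncate₆-≈ₚ f k (_ , above) k≤5 2 = refl
truncate₆-≈ₚ f k (_ , above) k≤5 3 = refl
truncate₆-≈ₚ f k (_ , above) k≤5 4 = refl
truncate₆-≈ₚ f k (_ , above) k≤5 5 = refl
truncate₆-≈ₚ f k (_ , above) k≤5 (suc (suc (suc (suc (suc (suc n)))))) =
  above _ (ℕ.≤-<-trans k≤5 (ℕ.m≤m+n 6 n))

-- A relation of degree at most 5 for μ reads o(z) μ = - e(z) with z = μ²,
-- the coefficients of o and e being those of odd and even index.
module LowDegree {A B C : ℚ} (noRoot : NoRationalRoot A B C)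
                 {μ : ℝ} (root : cubic A B C (μ ⊗ μ) ≃ 0ℝ) where

  open CubicIrrational {A} {B} {C} noRoot {μ ⊗ μ} root
  open SquareRoot {A} {B} {C} noRoot {μ} root

  lowDegree⇒isNorm : ∀ f k → Degree f k → k ℕ.≤ 5 → eval f μ ≃ 0ℝ → IsNorm A B C
  lowDegree⇒isNorm f k deg@(lead , _) k≤5 fμ≃0 =
    inField⇒isNorm (inField-÷ {c 1} {c 3} {c 5} {μ} odd≢0 (- c 0 , - c 2 , - c 4 ,
      combine₁ 1ℝ relation λ i → id (c 0) (c 1) (c 2) (c 3) (c 4) (c 5) (seq μ i)))
    where
    c : ℕ → ℚ
    c = coeff f
    relation : eval (truncate₆ f) μ ≃ 0ℝ
    relation = ≃-trans (≃-sym (eval-cong f (truncate₆ f) μ (truncate₆-≈ₚ f k deg k≤5))) fμ≃0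
    id : ∀ c₀ c₁ c₂ c₃ c₄ c₅ μ →
      (c₁ + c₃ * (μ * μ) + c₅ * (μ * μ * (μ * μ))) * μ - (- c₀ + - c₂ * (μ * μ) + - c₄ * (μ * μ * (μ * μ))) ≡
      1ℚ * (c₀ + μ * (c₁ + μ * (c₂ + μ * (c₃ + μ * (c₄ + μ * (c₅ + μ * 0ℚ))))) - 0ℚ)
    id = solve-∀ ℚ-ring
    id′ : ∀ c₀ c₁ c₂ c₃ c₄ c₅ μ →
      c₀ + c₂ * (μ * μ) + c₄ * (μ * μ * (μ * μ)) -
        (c₀ + μ * (c₁ + μ * (c₂ + μ * (c₃ + μ * (c₄ + μ * (c₅ + μ * 0ℚ)))))) ≡
      - 1ℚ * μ * (c₁ - 0ℚ) + - 1ℚ * (μ * (μ * μ)) * (c₃ - 0ℚ) + - 1ℚ * (μ * (μ * μ) * (μ * μ)) * (c₅ - 0ℚ)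
    id′ = solve-∀ ℚ-ring
    -- Without odd terms the relation is a quadratic one for z, so the even coefficients vanish as
    -- well, against the nonzero leading coefficient of f.
    odd≢0 : ¬ (c 1 ≡ 0ℚ × c 3 ≡ 0ℚ × c 5 ≡ 0ℚ)
    odd≢0 (c₁≡0 , c₃≡0 , c₅≡0) = vanish (quadratic-independent {c 0} {c 2} {c 4} (≃-trans
      (combine₃ (fromℚ (- 1ℚ) ⊗ μ) (fromℚ (- 1ℚ) ⊗ (μ ⊗ (μ ⊗ μ))) (fromℚ (- 1ℚ) ⊗ (μ ⊗ (μ ⊗ μ) ⊗ (μ ⊗ μ)))
        (fromℚ-cong c₁≡0) (fromℚ-cong c₃≡0) (fromℚ-cong c₅≡0)
        λ i → id′ (c 0) (c 1) (c 2) (c 3) (c 4) (c 5) (seq μ i)) relation))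
      where
      vanish : c 0 ≡ 0ℚ × c 2 ≡ 0ℚ × c 4 ≡ 0ℚ → ⊥
      vanish (c₀≡0 , c₂≡0 , c₄≡0) = lead (trans (truncate₆-≈ₚ f k deg k≤5 k) (all k))
        where
        all : IsZero (truncate₆ f)
        all 0 = c₀≡0
        all 1 = c₁≡0
        all 2 = c₂≡0
        all 3 = c₃≡0
        all 4 = c₄≡0
        all 5 = c₅≡0
        all (suc (suc (suc (suc (suc (suc _)))))) = refl

-- The coefficients of q beyond index 6 vanish, and the other factor, of degree suc k, uses up at
-- least one degree.
degree-≤6 : ∀ l m j k → coeff (q l m) (suc j ℕ.+ suc k) ≢ 0ℚ → suc j ℕ.≤ 5
degree-≤6 l m j k nonzero with suc j ℕ.+ suc k ℕ.≤? 6
... | yes j+k≤6 = ℕ.≤-trans (ℕ.m≤m+n (suc j) k) (ℕ.≤-pred (subst (ℕ._≤ 6) (ℕ.+-suc (suc j) k) j+k≤6))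
... | no j+k≰6 with n , eq ← ℕ.m≤n⇒∃[o]m+o≡n (ℕ.≰⇒> j+k≰6) =
  contradiction (subst (λ i → coeff (q l m) i ≡ 0ℚ) eq refl) nonzero

cubicOf : ℕ → ℕ → ℝ → ℝ
cubicOf l m = cubic (- fromℕ (l ℕ.+ m ℕ.+ 3)) (fromℕ (l ℕ.* m ℕ.+ l ℕ.+ m ℕ.+ 3)) (- 1ℚ)

eval-q : ∀ l m μ → eval (q l m) μ ≃ cubicOf l m (μ ⊗ μ)
eval-q l m μ = by-identity λ i → id (fromℕ (l ℕ.+ m ℕ.+ 3)) (fromℕ (l ℕ.* m ℕ.+ l ℕ.+ m ℕ.+ 3)) (seq μ i)
  where
  id : ∀ S T μ →
    - 1ℚ + μ * (0ℚ + μ * (T + μ * (0ℚ + μ * (- S + μ * (0ℚ + μ * (1ℚ + μ * 0ℚ))))))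
      - (μ * μ * (μ * μ) * (μ * μ) + - S * (μ * μ * (μ * μ)) + T * (μ * μ) + - 1ℚ) ≡ 0ℚ
  id = solve-∀ ℚ-ring

NoRationalRootOf : ℕ → ℕ → Set
NoRationalRootOf l m = NoRationalRoot (- fromℕ (l ℕ.+ m ℕ.+ 3)) (fromℕ (l ℕ.* m ℕ.+ l ℕ.+ m ℕ.+ 3)) (- 1ℚ)

IsNormOf : ℕ → ℕ → Set
IsNormOf l m = IsNorm (- fromℕ (l ℕ.+ m ℕ.+ 3)) (fromℕ (l ℕ.* m ℕ.+ l ℕ.+ m ℕ.+ 3)) (- 1ℚ)

-- One of the two factors vanishes at μ, and both have degree at most 5, so either of them yields
-- the norm. The conclusion no longer mentions μ: a single root settles it for all eigenvalues.
reducible⇒isNorm : ∀ l m → NoRationalRootOf l m → Reducible (q l m) →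
  ∀ {μ} → cubicOf l m (μ ⊗ μ) ≃ 0ℝ → ¬ ¬ IsNormOf l m
reducible⇒isNorm l m noRoot (g , h , g-nc , h-nc , q≈gh) {μ} root =
  go (nonConstant-degree g g-nc) (nonConstant-degree h h-nc)
  where
  open LowDegree noRoot {μ} root
  product≃0 : eval g μ ⊗ eval h μ ≃ 0ℝ
  product≃0 = ≃-trans (≃-sym (≃-trans (eval-cong (q l m) (g *ₚ h) μ q≈gh) (eval-*ₚ g h μ)))
    (≃-trans (eval-q l m μ) root)
  go : ∃[ j ] Degree g (suc j) → ∃[ k ] Degree h (suc k) → ¬ ¬ IsNormOf l m
  go (j , degᵍ) (k , degʰ) ¬norm =
    ¬norm (lowDegree⇒isNorm h (suc k) degʰ
      (degree-≤6 l m k j (subst (λ i → coeff (q l m) i ≢ 0ℚ) (ℕ.+-comm (suc j) (suc k)) leading≢0))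
      (x*y≃0⇒y≃0 (eval g μ) (eval h μ) product≃0 λ gμ≃0 →
        ¬norm (lowDegree⇒isNorm g (suc j) degᵍ (degree-≤6 l m j k leading≢0) gμ≃0)))
    where
    leading≢0 : coeff (q l m) (suc j ℕ.+ suc k) ≢ 0ℚ
    leading≢0 eq = proj₁ degʰ (p*q≡0⇒q≡0
      (trans (sym (leading-*ₚ g h (suc j) (suc k) degᵍ degʰ))
             (trans (sym (q≈gh (suc j ℕ.+ suc k))) eq)) (proj₁ degᵍ))

-- If a = 0 then A = 2 b and B = b².
norm-independentUpToOne : ∀ {A B C} → A * A ≢ (1ℚ + 1ℚ + 1ℚ + 1ℚ) * B → NoRationalRoot A B C →
  IsNorm A B C → IndependentUpToOne (PositiveRootOrOne λ x → cubic A B C (x ⊗ x))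
norm-independentUpToOne A²≢4B noRoot (norm a b d) = NormCubic.independentUpToOne a b d a≢0 noRoot
  where
  id : ∀ a b d → ((1ℚ + 1ℚ) * b - a * a) * ((1ℚ + 1ℚ) * b - a * a)
      - (1ℚ + 1ℚ + 1ℚ + 1ℚ) * (b * b - (1ℚ + 1ℚ) * a * d) ≡
    (a * a * a - (1ℚ + 1ℚ + 1ℚ + 1ℚ) * a * b + (1ℚ + 1ℚ) * (1ℚ + 1ℚ) * (1ℚ + 1ℚ) * d) * (a - 0ℚ)
  id = solve-∀ ℚ-ring
  a≢0 : a ≢ 0ℚ
  a≢0 a≡0 = A²≢4B (combineℚ₁ (a * a * a - (1ℚ + 1ℚ + 1ℚ + 1ℚ) * a * b + (1ℚ + 1ℚ) * (1ℚ + 1ℚ) * (1ℚ + 1ℚ) * d) a≡0 (id a b d))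

Candidates : ℕ → ℕ → ℝ → Set
Candidates l m = PositiveRootOrOne λ x → cubicOf l m (x ⊗ x)

module _ (l m : ℕ) where
  private
    S T L : ℚ
    S = fromℕ (l ℕ.+ m ℕ.+ 3)
    T = fromℕ (l ℕ.* m ℕ.+ l ℕ.+ m ℕ.+ 3)
    L = fromℕ (l ℕ.* m)

  T≡L+S : T ≡ L + S
  T≡L+S = trans (cong fromℕ (trans (cong (ℕ._+ 3) (ℕ.+-assoc (l ℕ.* m) l m)) (ℕ.+-assoc (l ℕ.* m) (l ℕ.+ m) 3)))
    (fromℕ-+ (l ℕ.* m) (l ℕ.+ m ℕ.+ 3))

  S+3 : S ≡ fromℕ l + fromℕ m + (1ℚ + 1ℚ + 1ℚ)
  S+3 = trans (fromℕ-+ (l ℕ.+ m) 3) (cong (_+ (1ℚ + 1ℚ + 1ℚ)) (fromℕ-+ l m))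

  -- Only 1 and -1 are possible, and there c takes the values lm and - (S + T + 2).
  no-rational-root : l ℕ.* m ≢ 0 → NoRationalRootOf l m
  no-rational-root lm≢0 r eq = case (rational-root s t r eq)
    where
    s t : ℕ
    s = l ℕ.+ m ℕ.+ 3
    t = l ℕ.* m ℕ.+ l ℕ.+ m ℕ.+ 3
    id₁ : ∀ S T L r → L - 0ℚ ≡
      1ℚ * (r * r * r + - S * (r * r) + T * r + - 1ℚ - 0ℚ) + - 1ℚ * (T - (L + S))
        + - (r * r + r + 1ℚ - S * (r + 1ℚ) + T) * (r - 1ℚ)
    id₁ = solve-∀ ℚ-ring
    id₂ : ∀ U S T r → U - 0ℚ ≡
      1ℚ * (U - (1ℚ + 1ℚ + (S + T))) + - 1ℚ * (r * r * r + - S * (r * r) + T * r + - 1ℚ - 0ℚ)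
        + (r * r - r + 1ℚ - S * (r - 1ℚ) + T) * (r - - 1ℚ)
    id₂ = solve-∀ ℚ-ring
    U≡ : fromℕ (2 ℕ.+ (s ℕ.+ t)) ≡ 1ℚ + 1ℚ + (S + T)
    U≡ = trans (fromℕ-+ 2 (s ℕ.+ t)) (cong (λ p → 1ℚ + 1ℚ + p) (fromℕ-+ s t))
    case : r ≡ 1ℚ ⊎ r ≡ - 1ℚ → ⊥
    case (inj₁ r≡1) = lm≢0 (fromℕ≡0⇒≡0 (l ℕ.* m)
      (combineℚ₃ 1ℚ (- 1ℚ) (- (r * r + r + 1ℚ - S * (r + 1ℚ) + T)) eq T≡L+S r≡1 (id₁ S T L r)))
    case (inj₂ r≡-1) = ℕ.1+n≢0 (fromℕ≡0⇒≡0 (2 ℕ.+ (s ℕ.+ t))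
      (combineℚ₃ 1ℚ (- 1ℚ) (r * r - r + 1ℚ - S * (r - 1ℚ) + T) U≡ eq r≡-1 (id₂ (fromℕ (2 ℕ.+ (s ℕ.+ t))) S T r)))

independentUpToOne-⊆ : ∀ {P Q : ℝ → Set} → (∀ {x} → P x → Q x) → IndependentUpToOne Q → IndependentUpToOne P
independentUpToOne-⊆ P⊆Q Q-ind = record
  { two   = λ Px Py → two (P⊆Q Px) (P⊆Q Py)
  ; three = λ Pw Px Py Pz → three (P⊆Q Pw) (P⊆Q Px) (P⊆Q Py) (P⊆Q Pz)
  ; five  = λ Pv Pw Px Py Pz → five (P⊆Q Pv) (P⊆Q Pw) (P⊆Q Px) (P⊆Q Py) (P⊆Q Pz)
  }
  where open IndependentUpToOne Q-ind

-- Reducibility can be exploited only at a candidate different from 1. If there is none, all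
-- candidates equal 1 and the claim is trivial; if there is one, it makes c a norm.
independent-lm≢0 : ∀ l m → Reducible (q (suc l) (suc m)) → ¬ ¬ IndependentUpToOne (Candidates (suc l) (suc m))
independent-lm≢0 l m reducible ¬ind = ¬ind (singleton-independentUpToOne λ { (0<x , root) x≄1 →
    reducible⇒isNorm (suc l) (suc m) noRoot reducible (root x≄1)
      λ isNorm → ¬ind (norm-independentUpToOne A²≢4B noRoot isNorm) })
  where
  noRoot : NoRationalRootOf (suc l) (suc m)
  noRoot = no-rational-root (suc l) (suc m) λ ()
  x y S T : ℚ
  x = fromℕ l
  y = fromℕ m
  S = fromℕ (suc l ℕ.+ suc m ℕ.+ 3)
  T = fromℕ (suc l ℕ.* suc m ℕ.+ suc l ℕ.+ suc m ℕ.+ 3)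
  S≡ : S ≡ 1ℚ + x + (1ℚ + y) + (1ℚ + 1ℚ + 1ℚ)
  S≡ = trans (S+3 (suc l) (suc m)) (cong (_+ (1ℚ + 1ℚ + 1ℚ)) (cong₂ _+_ (fromℕ-suc l) (fromℕ-suc m)))
  T≡ : T ≡ (1ℚ + x) * (1ℚ + y) + S
  T≡ = trans (T≡L+S (suc l) (suc m)) (cong (_+ S)
    (trans (fromℕ-* (suc l) (suc m)) (cong₂ _*_ (fromℕ-suc l) (fromℕ-suc m))))
  id : ∀ x y S T → (x - y) * (x - y) + ((1ℚ + 1ℚ) * (x + y) + 1ℚ) - 0ℚ ≡
    1ℚ * (- S * - S - (1ℚ + 1ℚ + 1ℚ + 1ℚ) * T)
      + (1ℚ + 1ℚ + 1ℚ + 1ℚ) * (T - ((1ℚ + x) * (1ℚ + y) + S))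
      + - (S + (1ℚ + x + y)) * (S - (1ℚ + x + (1ℚ + y) + (1ℚ + 1ℚ + 1ℚ)))
  id = solve-∀ ℚ-ring
  -- S² - 4 T = (x - y)² + 2 (x + y) + 1, where x and y are one less than the two parameters. Both
  -- being at least 1 makes the last two terms positive together.
  A²≢4B : - S * - S ≢ (1ℚ + 1ℚ + 1ℚ + 1ℚ) * T
  A²≢4B eq = square+positive≢0 (x - y) k-positive
    (combineℚ₃ 1ℚ (1ℚ + 1ℚ + 1ℚ + 1ℚ) (- (S + (1ℚ + x + y))) eq T≡ S≡ (id x y S T))
    where
    instance
      x-nonNeg : ℚ.NonNegative x
      x-nonNeg = ℚ.nonNegative (fromℕ-nonNegative l)
      y-nonNeg : ℚ.NonNegative y
      y-nonNeg = ℚ.nonNegative (fromℕ-nonNegative m)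
    k-positive : 0ℚ ℚ.< (1ℚ + 1ℚ) * (x + y) + 1ℚ
    k-positive = ℚ.positive⁻¹ _ {{ℚ.nonNeg+pos⇒pos ((1ℚ + 1ℚ) * (x + y))
      {{ℚ.nonNeg*nonNeg⇒nonNeg (1ℚ + 1ℚ) (x + y) {{ℚ.nonNeg+nonNeg⇒nonNeg x y}}}} 1ℚ}}

-- Candidates when lm = 0

module _ (l m : ℕ) (lm≡0 : l ℕ.* m ≡ 0) where
  private
    n : ℕ
    n = l ℕ.+ m
    N S T : ℚ
    N = fromℕ (2 ℕ.+ n)
    S = fromℕ (l ℕ.+ m ℕ.+ 3)
    T = fromℕ (l ℕ.* m ℕ.+ l ℕ.+ m ℕ.+ 3)

    S≡1+N : S ≡ 1ℚ + N
    S≡1+N = trans (cong fromℕ (ℕ.+-comm n 3)) (fromℕ-suc (2 ℕ.+ n))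

    T≡S : T ≡ S
    T≡S = trans (T≡L+S l m) (trans (cong (λ k → fromℕ k + S) lm≡0) (ℚ.+-identityˡ S))

    N≡2+n : N ≡ 1ℚ + 1ℚ + fromℕ n
    N≡2+n = fromℕ-+ 2 n

    quadratic-factor : ∀ {x} → Candidates l m x → x ≄ 1ℝ → quadratic 1ℚ (- N) 1ℚ (x ⊗ x) ≃ 0ℝ
    quadratic-factor {x} (0<x , root) x≄1 =
      x*y≃0⇒y≃0 (minus (x ⊗ x) (1ℝ ⊗ 1ℝ)) (quadratic 1ℚ (- N) 1ℚ (x ⊗ x))
        (combine₃ 1ℝ (x ⊗ x ⊗ (x ⊗ x) ⊕ fromℚ (- 1ℚ) ⊗ (x ⊗ x)) (fromℚ (- 1ℚ) ⊗ (x ⊗ x))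
          (root x≄1) (fromℚ-cong S≡1+N) (fromℚ-cong T≡S) λ i → id N S T (seq x i))
        (≄⇒difference≄0 (square-injective 0<x 1-positive x≄1))
      where
      id : ∀ N S T x → (x * x + - 1ℚ * (1ℚ * 1ℚ)) * (1ℚ + - N * (x * x) + 1ℚ * (x * x * (x * x))) - 0ℚ ≡
        1ℚ * (x * x * (x * x) * (x * x) + - S * (x * x * (x * x)) + T * (x * x) + - 1ℚ - 0ℚ)
          + (x * x * (x * x) + - 1ℚ * (x * x)) * (S - (1ℚ + N)) + - 1ℚ * (x * x) * (T - S)
      id = solve-∀ ℚ-ring

    -- Multiplication by r - 1 restores a cubic to which `rational-root` applies. At the two
    -- possible values 1 and -1 the quadratic equals - n and n + 4.
    noRoot : n ≢ 0 → ∀ r → r * r - N * r + 1ℚ ≢ 0ℚ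
    noRoot n≢0 r eq = case (rational-root (3 ℕ.+ n) (3 ℕ.+ n) r (combineℚ₂ (r - 1ℚ) (r - r * r) eq S≡1+N′ (id N (fromℕ (3 ℕ.+ n)) r)))
      where
      S≡1+N′ : fromℕ (3 ℕ.+ n) ≡ 1ℚ + N
      S≡1+N′ = fromℕ-suc (2 ℕ.+ n)
      id : ∀ N S r → r * r * r + - S * (r * r) + S * r + - 1ℚ - 0ℚ ≡
        (r - 1ℚ) * (r * r - N * r + 1ℚ - 0ℚ) + (r - r * r) * (S - (1ℚ + N))
      id = solve-∀ ℚ-ring
      id₁ : ∀ N n r → n - 0ℚ ≡ - 1ℚ * (r * r - N * r + 1ℚ - 0ℚ) + - 1ℚ * (N - (1ℚ + 1ℚ + n)) + (r + 1ℚ - N) * (r - 1ℚ)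
      id₁ = solve-∀ ℚ-ring
      id₂ : ∀ N M r → M - 0ℚ ≡ 1ℚ * (r * r - N * r + 1ℚ - 0ℚ) + 1ℚ * (M - (1ℚ + 1ℚ + N)) + (N + 1ℚ - r) * (r - - 1ℚ)
      id₂ = solve-∀ ℚ-ring
      case : r ≡ 1ℚ ⊎ r ≡ - 1ℚ → ⊥
      case (inj₁ r≡1)  = n≢0 (fromℕ≡0⇒≡0 n (combineℚ₃ (- 1ℚ) (- 1ℚ) (r + 1ℚ - N) eq N≡2+n r≡1 (id₁ N (fromℕ n) r)))
      case (inj₂ r≡-1) = ℕ.1+n≢0 (fromℕ≡0⇒≡0 (4 ℕ.+ n)
        (combineℚ₃ 1ℚ 1ℚ (N + 1ℚ - r) eq (fromℕ-+ 2 (2 ℕ.+ n)) r≡-1 (id₂ N (fromℕ (4 ℕ.+ n)) r)))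

    -- For N = 2 the quadratic factor is (z - 1)², so z = 1 is its only root.
    n≡0⇒singleton : n ≡ 0 → ∀ {x} → Candidates l m x → ¬ ¬ (x ≃ 1ℝ)
    n≡0⇒singleton n≡0 {x} Px@(0<x , _) x≄1 = z-1≄0 (x*y≃0⇒y≃0 z-1 z-1
        (combine₂ 1ℝ (x ⊗ x) (quadratic-factor Px x≄1) (fromℚ-cong N≡2) λ i → id N (seq x i)) z-1≄0)
      where
      z-1 : ℝ
      z-1 = minus (x ⊗ x) (1ℝ ⊗ 1ℝ)
      z-1≄0 : z-1 ≄ 0ℝ
      z-1≄0 = ≄⇒difference≄0 (square-injective 0<x 1-positive x≄1)
      N≡2 : N ≡ 1ℚ + 1ℚ
      N≡2 = cong (λ k → fromℕ (2 ℕ.+ k)) n≡0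
      id : ∀ N x → (x * x + - 1ℚ * (1ℚ * 1ℚ)) * (x * x + - 1ℚ * (1ℚ * 1ℚ)) - 0ℚ ≡
        1ℚ * (1ℚ + - N * (x * x) + 1ℚ * (x * x * (x * x)) - 0ℚ) + x * x * (N - (1ℚ + 1ℚ))
      id = solve-∀ ℚ-ring

  independent-lm≡0 : IndependentUpToOne (Candidates l m)
  independent-lm≡0 = case (n ℕ.≟ 0)
    where
    case : Dec (n ≡ 0) → IndependentUpToOne (Candidates l m)
    case (yes n≡0) = singleton-independentUpToOne (n≡0⇒singleton n≡0)
    case (no n≢0)  = independentUpToOne-⊆
      (λ Px → PositiveRootOrOne.positive Px , λ x≄1 → quadratic-factor Px x≄1)
      (ReciprocalQuadratic.independentUpToOne N (noRoot n≢0))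

candidates-independentUpToOne : ∀ l m → Reducible (q l m) → ¬ ¬ IndependentUpToOne (Candidates l m)
candidates-independentUpToOne zero    m       _         k = k (independent-lm≡0 0 m refl)
candidates-independentUpToOne (suc l) zero    _         k = k (independent-lm≡0 (suc l) 0 (ℕ.*-zeroʳ l))
candidates-independentUpToOne (suc l) (suc m) reducible k = independent-lm≢0 l m reducible k

-- Eigenvectors of T l m

⊕-cong : ∀ {x y z w} → x ≃ y → z ≃ w → x ⊕ z ≃ y ⊕ w
⊕-cong {x} {y} {z} {w} p q = combine₂ 1ℝ 1ℝ p q λ i → id (seq x i) (seq y i) (seq z i) (seq w i)
  where
  id : ∀ x y z w → x + z - (y + w) ≡ 1ℚ * (x - y) + 1ℚ * (z - w)
  id = solve-∀ ℚ-ring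

⊕-identityˡ : ∀ {x} → 0ℝ ⊕ x ≃ x
⊕-identityˡ {x} = by-identity λ i → id (seq x i)
  where
  id : ∀ x → 0ℚ + x - x ≡ 0ℚ
  id = solve-∀ ℚ-ring

⊕-identityʳ : ∀ {x} → x ⊕ 0ℝ ≃ x
⊕-identityʳ {x} = by-identity λ i → id (seq x i)
  where
  id : ∀ x → x + 0ℚ - x ≡ 0ℚ
  id = solve-∀ ℚ-ring

⊕-assoc : ∀ {x y z} → x ⊕ y ⊕ z ≃ x ⊕ (y ⊕ z)
⊕-assoc {x} {y} {z} = by-identity λ i → id (seq x i) (seq y i) (seq z i)
  where
  id : ∀ x y z → x + y + z - (x + (y + z)) ≡ 0ℚ
  id = solve-∀ ℚ-ring

sum-cong : ∀ {n} {f g : Vector ℝ n} → (∀ i → f i ≃ g i) → sum f ≃ sum g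
sum-cong {zero}  f≃g = ≃-refl
sum-cong {suc n} f≃g = ⊕-cong (f≃g zero) (sum-cong λ i → f≃g (suc i))

sum-zero : ∀ {n} {f : Vector ℝ n} → (∀ i → f i ≃ 0ℝ) → sum f ≃ 0ℝ
sum-zero {zero}  f≃0 = ≃-refl
sum-zero {suc n} f≃0 = ≃-trans (⊕-cong (f≃0 zero) (sum-zero λ i → f≃0 (suc i))) ⊕-identityˡ

sum-single : ∀ {n} (f : Vector ℝ n) a → (∀ b → a ≢ b → f b ≃ 0ℝ) → sum f ≃ f a
sum-single f zero    f≃0 = ≃-trans (⊕-cong ≃-refl (sum-zero λ b → f≃0 (suc b) λ ())) ⊕-identityʳ
sum-single f (suc a) f≃0 = ≃-trans
  (⊕-cong (f≃0 zero λ ()) (sum-single (λ b → f (suc b)) a λ b a≢b → f≃0 (suc b) λ eq → a≢b (Fin.suc-injective eq)))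
  ⊕-identityˡ

sum-↑ : ∀ m {n} (f : Vector ℝ (m ℕ.+ n)) → sum f ≃ sum (λ i → f (i ↑ˡ n)) ⊕ sum (λ j → f (m ↑ʳ j))
sum-↑ zero    f = ≃-sym ⊕-identityˡ
sum-↑ (suc m) f = ≃-trans (⊕-cong ≃-refl (sum-↑ m (λ i → f (suc i)))) (≃-sym ⊕-assoc)

sum-combine : ∀ l n (f : Vector ℝ (l ℕ.* n)) → sum f ≃ sum (λ (a : Fin l) → sum (λ (u : Fin n) → f (combine a u)))
sum-combine zero    n f = ≃-refl
sum-combine (suc l) n f = ≃-trans (sum-↑ n f) (⊕-cong ≃-refl (sum-combine l n λ k → f (n ↑ʳ k)))

sum-constant : ∀ {n} t c {f : Vector ℝ n} → (∀ i → t ⊗ f i ≃ c) → t ⊗ sum f ≃ fromℚ (fromℕ n) ⊗ c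
sum-constant {zero} t c h = by-identity λ i → id (seq t i) (seq c i)
  where
  id : ∀ t c → t * 0ℚ - 0ℚ * c ≡ 0ℚ
  id = solve-∀ ℚ-ring
sum-constant {suc n} t c {f} h =
  combine₃ 1ℝ 1ℝ (fromℚ (- 1ℚ) ⊗ c) (h zero) (sum-constant t c λ i → h (suc i)) (fromℚ-cong (fromℕ-suc n))
    λ i → id (seq t i) (seq c i) (seq (f zero) i) (seq (sum λ j → f (suc j)) i) (fromℕ n) (fromℕ (suc n))
  where
  id : ∀ t c x s n n′ → t * (x + s) - n′ * c ≡
    1ℚ * (t * x - c) + 1ℚ * (t * s - n * c) + - 1ℚ * c * (n′ - (1ℚ + n))
  id = solve-∀ ℚ-ring

-- Rows of the adjacency matrix under `bridge` and `coalesce`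

bit : Bool → ℝ
bit b = if b then 1ℝ else 0ℝ

bit-cong : ∀ {b c} x → b ≡ c → bit b ⊗ x ≃ bit c ⊗ x
bit-cong x refl = ≃-refl

0⊗ : ∀ x → 0ℝ ⊗ x ≃ 0ℝ
0⊗ x = by-identity λ i → id (seq x i)
  where
  id : ∀ x → 0ℚ * x - 0ℚ ≡ 0ℚ
  id = solve-∀ ℚ-ring

1⊗ : ∀ x → 1ℝ ⊗ x ≃ x
1⊗ x = by-identity λ i → id (seq x i)
  where
  id : ∀ x → 1ℚ * x - x ≡ 0ℚ
  id = solve-∀ ℚ-ring

bit-false : ∀ {b} x → b ≡ false → bit b ⊗ x ≃ 0ℝ
bit-false x refl = 0⊗ x

bit-true : ∀ {b} x → b ≡ true → bit b ⊗ x ≃ x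
bit-true x refl = 1⊗ x

-- This unfolds to the row sum in `Eigenvalue` for `adjacencyMatrix G`, so eigenvector equations
-- apply to it without conversion.
neighbourSum : ∀ {n} → Graph n → Vector ℝ n → Vector ℝ n
neighbourSum G v i = sum λ j → bit (G i j) ⊗ v j

module Bridge {m n} (G : Graph (suc m)) (H : Graph (suc n)) where

  left : Fin (suc m) → Fin (suc m ℕ.+ suc n)
  left i = i ↑ˡ suc n

  right : Fin (suc n) → Fin (suc m ℕ.+ suc n)
  right j = suc m ↑ʳ j

  bridge-left-left : ∀ i j → bridge G H (left i) (left j) ≡ G i j
  bridge-left-left i j rewrite Fin.splitAt-↑ˡ (suc m) i (suc n) | Fin.splitAt-↑ˡ (suc m) j (suc n) = refl

  bridge-right-right : ∀ i j → bridge G H (right i) (right j) ≡ H i j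
  bridge-right-right i j rewrite Fin.splitAt-↑ʳ (suc m) (suc n) i | Fin.splitAt-↑ʳ (suc m) (suc n) j = refl

  bridge-zero-zero : bridge G H (left zero) (right zero) ≡ true
  bridge-zero-zero rewrite Fin.splitAt-↑ʳ (suc m) (suc n) zero = refl

  bridge-zero-suc : ∀ j → bridge G H (left zero) (right (suc j)) ≡ false
  bridge-zero-suc j rewrite Fin.splitAt-↑ʳ (suc m) (suc n) (suc j) = refl

  bridge-suc-right : ∀ i j → bridge G H (left (suc i)) (right j) ≡ false
  bridge-suc-right i j rewrite Fin.splitAt-↑ˡ (suc m) (suc i) (suc n) | Fin.splitAt-↑ʳ (suc m) (suc n) j = refl

  bridge-zero-zero′ : bridge G H (right zero) (left zero) ≡ true
  bridge-zero-zero′ rewrite Fin.splitAt-↑ʳ (suc m) (suc n) zero = refl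

  bridge-zero-suc′ : ∀ i → bridge G H (right zero) (left (suc i)) ≡ false
  bridge-zero-suc′ i rewrite Fin.splitAt-↑ʳ (suc m) (suc n) zero | Fin.splitAt-↑ˡ (suc m) (suc i) (suc n) = refl

  bridge-suc-left : ∀ i j → bridge G H (right (suc i)) (left j) ≡ false
  bridge-suc-left i j rewrite Fin.splitAt-↑ʳ (suc m) (suc n) (suc i) | Fin.splitAt-↑ˡ (suc m) j (suc n) = refl

  module _ (v : Vector ℝ (suc m ℕ.+ suc n)) where
    vˡ : Vector ℝ (suc m)
    vˡ i = v (left i)

    vʳ : Vector ℝ (suc n)
    vʳ j = v (right j)

    private
      split : ∀ i → neighbourSum (bridge G H) v i ≃
        sum (λ j → bit (bridge G H i (left j)) ⊗ vˡ j) ⊕ sum (λ j → bit (bridge G H i (right j)) ⊗ vʳ j)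
      split i = sum-↑ (suc m) (λ j → bit (bridge G H i j) ⊗ v j)

    left-suc : ∀ i → neighbourSum (bridge G H) v (left (suc i)) ≃ neighbourSum G vˡ (suc i)
    left-suc i = ≃-trans (split (left (suc i))) (≃-trans (⊕-cong
      (sum-cong λ j → bit-cong (vˡ j) (bridge-left-left (suc i) j))
      (sum-zero λ j → bit-false (vʳ j) (bridge-suc-right i j))) ⊕-identityʳ)

    right-suc : ∀ i → neighbourSum (bridge G H) v (right (suc i)) ≃ neighbourSum H vʳ (suc i)
    right-suc i = ≃-trans (split (right (suc i))) (≃-trans (⊕-cong
      (sum-zero λ j → bit-false (vˡ j) (bridge-suc-left i j))
      (sum-cong λ j → bit-cong (vʳ j) (bridge-right-right (suc i) j))) ⊕-identityˡ)

    left-zero : neighbourSum (bridge G H) v (left zero) ≃ neighbourSum G vˡ zero ⊕ vʳ zero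
    left-zero = ≃-trans (split (left zero)) (⊕-cong
      (sum-cong λ j → bit-cong (vˡ j) (bridge-left-left zero j))
      (≃-trans (⊕-cong (bit-true (vʳ zero) bridge-zero-zero)
                       (sum-zero λ j → bit-false (vʳ (suc j)) (bridge-zero-suc j))) ⊕-identityʳ))

    right-zero : neighbourSum (bridge G H) v (right zero) ≃ vˡ zero ⊕ neighbourSum H vʳ zero
    right-zero = ≃-trans (split (right zero)) (⊕-cong
      (≃-trans (⊕-cong (bit-true (vˡ zero) bridge-zero-zero′)
                       (sum-zero λ j → bit-false (vˡ (suc j)) (bridge-zero-suc′ j))) ⊕-identityʳ)
      (sum-cong λ j → bit-cong (vʳ j) (bridge-right-right zero j)))

module Coalesce (l : ℕ) {n} (G : Graph (suc n)) (v : Vector ℝ (suc (l ℕ.* n))) where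

  inCopy : Fin l → Fin n → Fin (suc (l ℕ.* n))
  inCopy a u = suc (combine a u)

  coalesce-zero : ∀ a u → coalesce l G zero (inCopy a u) ≡ G zero (suc u)
  coalesce-zero a u = cong (λ p → G zero (suc (proj₂ p))) (Fin.remQuot-combine {l} {n} a u)

  coalesce-to-zero : ∀ a u → coalesce l G (inCopy a u) zero ≡ G (suc u) zero
  coalesce-to-zero a u = cong (λ p → G (suc (proj₂ p)) zero) (Fin.remQuot-combine {l} {n} a u)

  coalesce-copies : ∀ a b u w →
    coalesce l G (inCopy a u) (inCopy b w) ≡ ⌊ a Fin.≟ b ⌋ ∧ G (suc u) (suc w)
  coalesce-copies a b u w = cong₂ (λ p r → ⌊ proj₁ p Fin.≟ proj₁ r ⌋ ∧ G (suc (proj₂ p)) (suc (proj₂ r)))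
    (Fin.remQuot-combine {l} {n} a u) (Fin.remQuot-combine {l} {n} b w)

  coalesce-same : ∀ a u w → coalesce l G (inCopy a u) (inCopy a w) ≡ G (suc u) (suc w)
  coalesce-same a u w = trans (coalesce-copies a a u w) (same (a Fin.≟ a))
    where
    same : (d : Dec (a ≡ a)) → ⌊ d ⌋ ∧ G (suc u) (suc w) ≡ G (suc u) (suc w)
    same (yes _)  = refl
    same (no a≢a) = contradiction refl a≢a

  coalesce-other : ∀ a b u w → a ≢ b → coalesce l G (inCopy a u) (inCopy b w) ≡ false
  coalesce-other a b u w a≢b = trans (coalesce-copies a b u w) (other (a Fin.≟ b))
    where
    other : (d : Dec (a ≡ b)) → ⌊ d ⌋ ∧ G (suc u) (suc w) ≡ false
    other (yes a≡b) = contradiction a≡b a≢b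
    other (no _)    = refl

  centre : neighbourSum (coalesce l G) v zero ≃ sum λ a → sum λ u → bit (G zero (suc u)) ⊗ v (inCopy a u)
  centre = ≃-trans (⊕-cong (0⊗ (v zero)) (sum-combine l n λ k → bit (coalesce l G zero (suc k)) ⊗ v (suc k)))
    (≃-trans ⊕-identityˡ (sum-cong λ a → sum-cong λ u → bit-cong (v (inCopy a u)) (coalesce-zero a u)))

  copy : ∀ a u → neighbourSum (coalesce l G) v (inCopy a u) ≃
    bit (G (suc u) zero) ⊗ v zero ⊕ sum λ w → bit (G (suc u) (suc w)) ⊗ v (inCopy a w)
  copy a u = ⊕-cong (bit-cong (v zero) (coalesce-to-zero a u))
    (≃-trans (sum-combine l n λ k → bit (coalesce l G (inCopy a u) (suc k)) ⊗ v (suc k))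
      (≃-trans (sum-single (λ b → sum λ w → bit (coalesce l G (inCopy a u) (inCopy b w)) ⊗ v (inCopy b w)) a
                  λ b a≢b → sum-zero λ w → bit-false (v (inCopy b w)) (coalesce-other a b u w a≢b))
               (sum-cong λ w → bit-cong (v (inCopy a w)) (coalesce-same a u w))))

module Star (l : ℕ) (v : Vector ℝ (suc (l ℕ.* 2))) where
  open Coalesce l (path 3) v

  near far : Fin l → ℝ
  near a = v (inCopy a 0F)
  far  a = v (inCopy a 1F)

  private
    select₀ : ∀ x y → 1ℝ ⊗ x ⊕ (0ℝ ⊗ y ⊕ 0ℝ) ≃ x
    select₀ x y = by-identity λ i → id (seq x i) (seq y i)
      where
      id : ∀ x y → 1ℚ * x + (0ℚ * y + 0ℚ) - x ≡ 0ℚ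
      id = solve-∀ ℚ-ring

    select₀₁ : ∀ c x y → 1ℝ ⊗ c ⊕ (0ℝ ⊗ x ⊕ (1ℝ ⊗ y ⊕ 0ℝ)) ≃ c ⊕ y
    select₀₁ c x y = by-identity λ i → id (seq c i) (seq x i) (seq y i)
      where
      id : ∀ c x y → 1ℚ * c + (0ℚ * x + (1ℚ * y + 0ℚ)) - (c + y) ≡ 0ℚ
      id = solve-∀ ℚ-ring

    select₁ : ∀ c x y → 0ℝ ⊗ c ⊕ (1ℝ ⊗ x ⊕ (0ℝ ⊗ y ⊕ 0ℝ)) ≃ x
    select₁ c x y = by-identity λ i → id (seq c i) (seq x i) (seq y i)
      where
      id : ∀ c x y → 0ℚ * c + (1ℚ * x + (0ℚ * y + 0ℚ)) - x ≡ 0ℚ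
      id = solve-∀ ℚ-ring

  centre-sum : neighbourSum (subdividedStar l) v zero ≃ sum near
  centre-sum = ≃-trans centre (sum-cong λ a → select₀ (near a) (far a))

  near-sum : ∀ a → neighbourSum (subdividedStar l) v (inCopy a 0F) ≃ v zero ⊕ far a
  near-sum a = ≃-trans (copy a 0F) (select₀₁ (v zero) (near a) (far a))

  far-sum : ∀ a → neighbourSum (subdividedStar l) v (inCopy a 1F) ≃ near a
  far-sum a = ≃-trans (copy a 1F) (select₁ (v zero) (near a) (far a))

  -- Only the rows of the noncentral vertices are assumed: the centre has one more neighbour, across
  -- the bridge, whose entry enters as w in `centre-relation`.
  module Eigenvector (μ : ℝ)
    (eqs : ∀ k → neighbourSum (subdividedStar l) v (suc k) ≃ μ ⊗ v (suc k)) where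

    -- The 1 is written as a square, the form in which `square-injective` shows that μ² differs from
    -- it.
    z-1 : ℝ
    z-1 = minus (μ ⊗ μ) (1ℝ ⊗ 1ℝ)

    private
      near-eq : ∀ a → v zero ⊕ far a ≃ μ ⊗ near a
      near-eq a = ≃-trans (≃-sym (near-sum a)) (eqs (combine a 0F))

      far-eq : ∀ a → near a ≃ μ ⊗ far a
      far-eq a = ≃-trans (≃-sym (far-sum a)) (eqs (combine a 1F))

      near-centre : ∀ a → z-1 ⊗ near a ≃ μ ⊗ v zero
      near-centre a = combine₂ (fromℚ (- 1ℚ) ⊗ μ) (fromℚ (- 1ℚ)) (near-eq a) (far-eq a)
        λ i → id (seq μ i) (seq (v zero) i) (seq (near a) i) (seq (far a) i)
        where
        id : ∀ μ u x y → (μ * μ + - 1ℚ * (1ℚ * 1ℚ)) * x - μ * u ≡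
          - 1ℚ * μ * (u + y - μ * x) + - 1ℚ * (x - μ * y)
        id = solve-∀ ℚ-ring

    -- Each copy has (z - 1) near = μ v₀, with v₀ the entry at the centre, so the l copies
    -- contribute l μ v₀ to z - 1 times the central row. The rest of that row is (z - 1) w = μ (z -
    -- 1 - l) v₀.
    centre-relation : ∀ w → neighbourSum (subdividedStar l) v zero ⊕ w ≃ μ ⊗ v zero →
      z-1 ⊗ w ≃ μ ⊗ (minus z-1 (fromℚ (fromℕ l))) ⊗ v zero
    centre-relation w eq = combine₃ z-1 (fromℚ (- 1ℚ)) (fromℚ (- 1ℚ) ⊗ z-1)
      eq (sum-constant z-1 (μ ⊗ v zero) near-centre) centre-sum
      λ i → id (fromℕ l) (seq z-1 i) (seq μ i) (seq (v zero) i) (seq w i) (seq (sum near) i)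
               (seq (neighbourSum (subdividedStar l) v zero) i)
      where
      id : ∀ l t μ u w s r → t * w - μ * (t + - 1ℚ * l) * u ≡
        t * (r + w - μ * u) + - 1ℚ * (t * s - l * (μ * u)) + - 1ℚ * t * (r - s)
      id = solve-∀ ℚ-ring

    zero-centre⇒zero : z-1 ≄ 0ℝ → v zero ≃ 0ℝ → ∀ i → v i ≃ 0ℝ
    zero-centre⇒zero z-1≄0 u≃0 zero    = u≃0
    zero-centre⇒zero z-1≄0 u≃0 (suc k) =
      subst (λ j → v (suc j) ≃ 0ℝ) (Fin.combine-remQuot {l} 2 k) (copies (proj₁ (remQuot {l} 2 k)) (proj₂ (remQuot {l} 2 k)))
      where
      near≃0 : ∀ a → near a ≃ 0ℝ
      near≃0 a = x*y≃0⇒y≃0 z-1 (near a)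
        (combine₂ 1ℝ μ (near-centre a) u≃0 λ i → id (seq z-1 i) (seq (near a) i) (seq μ i) (seq (v zero) i)) z-1≄0
        where
        id : ∀ t x μ u → t * x - 0ℚ ≡ 1ℚ * (t * x - μ * u) + μ * (u - 0ℚ)
        id = solve-∀ ℚ-ring
      copies : ∀ a u → v (suc (combine a u)) ≃ 0ℝ
      copies a 0F = near≃0 a
      copies a 1F = combine₃ 1ℝ (fromℚ (- 1ℚ)) μ (near-eq a) u≃0 (near≃0 a)
        λ i → id (seq μ i) (seq (v zero) i) (seq (near a) i) (seq (far a) i)
        where
        id : ∀ μ u x y → y - 0ℚ ≡ 1ℚ * (u + y - μ * x) + - 1ℚ * (u - 0ℚ) + μ * (x - 0ℚ)
        id = solve-∀ ℚ-ring

positiveEigenvalue⇒candidate : ∀ l m μ →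
  PositiveEigenvalue (adjacencyMatrix (doubleSubdividedStar l m)) μ → Candidates l m μ
positiveEigenvalue⇒candidate l m μ ((v , v≉0 , eqs) , 0<μ) = 0<μ , λ μ≄1 → ≃0-stable (root μ≄1)
  where
  open Bridge (subdividedStar l) (subdividedStar m)
  open Star l (vˡ v) using () renaming (module Eigenvector to Eigenvectorˡ)
  open Star m (vʳ v) using () renaming (module Eigenvector to Eigenvectorʳ)

  rows : ∀ i → neighbourSum (doubleSubdividedStar l m) v i ≃ μ ⊗ v i
  rows i = wrap (eqs i)

  module Eˡ = Eigenvectorˡ μ (λ k → ≃-trans (≃-sym (left-suc v k)) (rows (left (suc k))))
  module Eʳ = Eigenvectorʳ μ (λ k → ≃-trans (≃-sym (right-suc v k)) (rows (right (suc k))))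

  u w z-1 : ℝ
  u   = vˡ v zero
  w   = vʳ v zero
  z-1 = minus (μ ⊗ μ) (1ℝ ⊗ 1ℝ)

  relationˡ : z-1 ⊗ w ≃ μ ⊗ (minus z-1 (fromℚ (fromℕ l))) ⊗ u
  relationˡ = Eˡ.centre-relation w (≃-trans (≃-sym (left-zero v)) (rows (left zero)))

  relationʳ : z-1 ⊗ u ≃ μ ⊗ (minus z-1 (fromℚ (fromℕ m))) ⊗ w
  relationʳ = Eʳ.centre-relation u (≃-trans (⊕-comm (neighbourSum (subdividedStar m) (vʳ v) zero) u)
      (≃-trans (≃-sym (right-zero v)) (rows (right zero))))
    where
    ⊕-comm : ∀ x y → x ⊕ y ≃ y ⊕ x
    ⊕-comm x y = by-identity λ i → id (seq x i) (seq y i)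
      where
      id : ∀ x y → x + y - (y + x) ≡ 0ℚ
      id = solve-∀ ℚ-ring

  L M : ℚ
  L = fromℕ l
  M = fromℕ m

  T≡ : fromℕ (l ℕ.* m ℕ.+ l ℕ.+ m ℕ.+ 3) ≡ L * M + (L + M + (1ℚ + 1ℚ + 1ℚ))
  T≡ = trans (T≡L+S l m) (cong₂ _+_ (fromℕ-* l m) (S+3 l m))

  -- Eliminating w from the two relations.
  eliminated : cubic (- (L + M + (1ℚ + 1ℚ + 1ℚ))) (L * M + (L + M + (1ℚ + 1ℚ + 1ℚ))) (- 1ℚ) (μ ⊗ μ) ⊗ u ≃ 0ℝ
  eliminated = combine₂ (fromℚ (- 1ℚ) ⊗ z-1) (fromℚ (- 1ℚ) ⊗ (μ ⊗ minus z-1 (fromℚ M)))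
    relationʳ relationˡ λ i → id L M (seq μ i) (seq u i) (seq w i)
    where
    id : ∀ L M μ u w →
      (μ * μ * (μ * μ) * (μ * μ) + - (L + M + (1ℚ + 1ℚ + 1ℚ)) * (μ * μ * (μ * μ))
        + (L * M + (L + M + (1ℚ + 1ℚ + 1ℚ))) * (μ * μ) + - 1ℚ) * u - 0ℚ ≡
      - 1ℚ * (μ * μ + - 1ℚ * (1ℚ * 1ℚ)) *
        ((μ * μ + - 1ℚ * (1ℚ * 1ℚ)) * u - μ * (μ * μ + - 1ℚ * (1ℚ * 1ℚ) + - 1ℚ * M) * w)
      + - 1ℚ * (μ * (μ * μ + - 1ℚ * (1ℚ * 1ℚ) + - 1ℚ * M)) *
        ((μ * μ + - 1ℚ * (1ℚ * 1ℚ)) * w - μ * (μ * μ + - 1ℚ * (1ℚ * 1ℚ) + - 1ℚ * L) * u)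
    id = solve-∀ ℚ-ring

  -- The product c(z) u is 0. If c(z) is not 0, then u = 0; as z ≠ 1, `relationˡ` gives w = 0, and
  -- zero centres force the whole eigenvector to be 0. Being nonzero is only a negative statement
  -- about v, so the conclusion is doubly negated at first.
  root : μ ≄ 1ℝ → ¬ (cubicOf l m (μ ⊗ μ) ≄ 0ℝ)
  root μ≄1 c≄0 = v≉0 λ i → unwrap (all i)
    where
    z-1≄0 : z-1 ≄ 0ℝ
    z-1≄0 = ≄⇒difference≄0 (square-injective 0<μ 1-positive μ≄1)
    u≃0 : u ≃ 0ℝ
    u≃0 = x*y≃0⇒y≃0 (cubicOf l m (μ ⊗ μ)) u
      (subst₂ (λ S T → cubic (- S) T (- 1ℚ) (μ ⊗ μ) ⊗ u ≃ 0ℝ) (sym (S+3 l m)) (sym T≡) eliminated) c≄0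
    id : ∀ t w k u → t * w - 0ℚ ≡ 1ℚ * (t * w - k * u) + k * (u - 0ℚ)
    id = solve-∀ ℚ-ring
    w≃0 : w ≃ 0ℝ
    w≃0 = x*y≃0⇒y≃0 z-1 w
      (combine₂ 1ℝ (μ ⊗ minus z-1 (fromℚ L)) relationˡ u≃0
        λ i → id (seq z-1 i) (seq w i) (seq (μ ⊗ minus z-1 (fromℚ L)) i) (seq u i)) z-1≄0
    all : ∀ i → v i ≃ 0ℝ
    all i = side (splitAt (suc (l ℕ.* 2)) i) refl
      where
      side : ∀ s → splitAt (suc (l ℕ.* 2)) i ≡ s → v i ≃ 0ℝ
      side (inj₁ j) eq = subst (λ k → v k ≃ 0ℝ) (Fin.splitAt⁻¹-↑ˡ eq) (Eˡ.zero-centre⇒zero z-1≄0 u≃0 j)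
      side (inj₂ j) eq = subst (λ k → v k ≃ 0ℝ) (Fin.splitAt⁻¹-↑ʳ eq) (Eʳ.zero-centre⇒zero z-1≄0 w≃0 j)

-- Linear independence of finite families after the removal of one element

module _ {P : Pred ℝ 0ℓ} (positive : ∀ {x} → P x → 0ℝ < x) (ind : IndependentUpToOne P) where
  open IndependentUpToOne ind

  private
    independent : ∀ {μ} → P μ → ∀ n (x : Vector ℝ n) → (∀ i → P (x i)) → (∀ i → x i ≄ μ) →
      (∀ {i j} → i ≢ j → x i ≄ x j) →
      ∀ (c : Vector ℚ n) → sum (λ i → fromℚ (c i) ⊗ x i) ≃ 0ℝ → ∀ i → c i ≡ 0ℚ
    independent Pμ 1 x Px x≄μ distinct c eq 0F = fromℚ≃0⇒≡0 (x*y≃0⇒y≃0 (x 0F) (fromℚ (c 0F))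
        (combine₁ 1ℝ eq λ i → id (c 0F) (seq (x 0F) i)) (positive⇒≄0 (positive (Px 0F))))
      where
      id : ∀ c x → x * c - 0ℚ ≡ 1ℚ * (c * x + 0ℚ - 0ℚ)
      id = solve-∀ ℚ-ring
    independent Pμ 2 x Px x≄μ distinct c eq = select (two (Px 0F) (Px 1F) (distinct λ ())
        (combine₁ 1ℝ eq λ i → id (c 0F) (c 1F) (seq (x 0F) i) (seq (x 1F) i)))
      where
      id : ∀ c d x y → c * x + d * y - 0ℚ ≡ 1ℚ * (c * x + (d * y + 0ℚ) - 0ℚ)
      id = solve-∀ ℚ-ring
      select : c 0F ≡ 0ℚ × c 1F ≡ 0ℚ → ∀ i → c i ≡ 0ℚ
      select (c₀≡0 , _) 0F = c₀≡0
      select (_ , c₁≡0) 1F = c₁≡0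
    independent Pμ 3 x Px x≄μ distinct c eq = select (three Pμ (Px 0F) (Px 1F) (Px 2F)
        (x≄μ 0F) (x≄μ 1F) (x≄μ 2F) (distinct λ ()) (distinct λ ()) (distinct λ ())
        (combine₁ 1ℝ eq λ i → id (c 0F) (c 1F) (c 2F) (seq (x 0F) i) (seq (x 1F) i) (seq (x 2F) i)))
      where
      id : ∀ c d e x y z → c * x + d * y + e * z - 0ℚ ≡ 1ℚ * (c * x + (d * y + (e * z + 0ℚ)) - 0ℚ)
      id = solve-∀ ℚ-ring
      select : c 0F ≡ 0ℚ × c 1F ≡ 0ℚ × c 2F ≡ 0ℚ → ∀ i → c i ≡ 0ℚ
      select (c₀≡0 , _ , _) 0F = c₀≡0
      select (_ , c₁≡0 , _) 1F = c₁≡0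
      select (_ , _ , c₂≡0) 2F = c₂≡0
    -- The first four members together with the removed μ would be five distinct elements.
    independent Pμ (suc (suc (suc (suc n)))) x Px x≄μ distinct c eq = ⊥-elim
      (five (Px 0F) (Px 1F) (Px 2F) (Px 3F) Pμ
        (distinct λ ()) (distinct λ ()) (distinct λ ()) (x≄μ 0F)
        (distinct λ ()) (distinct λ ()) (x≄μ 1F) (distinct λ ()) (x≄μ 2F) (x≄μ 3F))

  linearlyIndependent-∖ : ∀ {μ} → P μ → LinearlyIndependent (P ∖ μ)
  linearlyIndependent-∖ Pμ n x x∈ x-injective c eq = independent Pμ n x (λ i → proj₁ (x∈ i))
    (λ i xᵢ≃μ → proj₂ (x∈ i) (unwrap xᵢ≃μ)) (λ i≢j xᵢ≃xⱼ → i≢j (x-injective (unwrap xᵢ≃xⱼ))) c (wrap eq)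

theorem2p2 : (l m : ℕ) → Reducible (q l m) →
    (μ : ℝ) → PositiveEigenvalue (adjacencyMatrix (doubleSubdividedStar l m)) μ →
    LinearlyIndependent (PositiveEigenvalue (adjacencyMatrix (doubleSubdividedStar l m)) ∖ μ)
theorem2p2 l m reducible μ μ-eigen n x x∈ x-inj c eq i =
  decidable-stable (c i ℚ.≟ 0ℚ) λ cᵢ≢0 →
    candidates-independentUpToOne l m reducible λ ind →
      cᵢ≢0 (linearlyIndependent-∖ {Candidates l m} (λ {y} → PositiveRootOrOne.positive {x = y}) ind (positiveEigenvalue⇒candidate l m μ μ-eigen)
        n x (λ j → positiveEigenvalue⇒candidate l m (x j) (proj₁ (x∈ j)) , proj₂ (x∈ j)) x-inj c eq i)
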